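{- Let $m\geq 1$ and $0\leq l\leq m$, let $1\leq i_1\leq\cdots\leq i_l$ and $1\leq i_{l+1}\leq\cdots\leq i_m$ be integers, and let $q\geq 2$ be an integer. For a composition $\theta=(\theta_1,\theta_2,\ldots,\theta_p)\in\mathcal{C}_m$ (where $p$ is the number of parts of $\theta$), a permutation $\rho\in\mathcal{S}_m$ and $c=1,2,\ldots,p$, put $$\lambda_c=\sum_{k=1}^{\theta_c}\chi_{\mathbb{N}}\big(\rho(\theta_1+\cdots+\theta_{c-1}+k)-l\big),$$ $$\tilde{T}_c(\theta,\rho)=\begin{cases}\overline{i_{\rho(\theta_1+\cdots+\theta_{c-1}+1)}+\cdots+i_{\rho(\theta_1+\cdots+\theta_c)}}, & \text{if }\lambda_c\text{ is odd},\\ i_{\rho(\theta_1+\cdots+\theta_{c-1}+1)}+\cdots+i_{\rho(\theta_1+\cdots+\theta_c)}, & \text{if }\lambda_c\text{ is even},\end{cases}$$ $$\hat{T}_1(\theta,\rho)=\begin{cases}\overline{q+i_{\rho(1)}+\cdots+i_{\rho(\theta_1)}}, & \text{if }\lambda_1\text{ is odd},\\ q+i_{\rho(1)}+\cdots+i_{\rho(\theta_1)}, & \text{if }\lambda_1\text{ is even}.\end{cases}$$ Then $$S_{i_1\cdots i_l\bar{i}_{l+1}\cdots\bar{i}_m,q}=\sum_{\theta\in\mathcal{C}_m}\sum_{\rho\in\mathcal{S}_m}\frac{(-1)^{\lambda_1+\cdots+\lambda_p}}{\theta_1!\cdots\theta_p!}\Big\{\zeta\big(q,\tilde{T}_1(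\theta,\rho),\ldots,\tilde{T}_p(\theta,\rho)\big)+\zeta\big(\hat{T}_1(\theta,\rho),\tilde{T}_2(\theta,\rho),\ldots,\tilde{T}_p(\theta,\rho)\big)\Big\}.$$
   Context: Harmonic numbers and alternating harmonic numbers: $H_n^{(r)}=\sum_{k=1}^n\frac{1}{k^r}$ and $\bar{H}_n^{(r)}=\sum_{k=1}^n\frac{(-1)^{k-1}}{k^r}$ for positive integers $n,r$. Alternating Euler sums (first kind): $$S_{i_1\cdots i_l\bar{i}_{l+1}\cdots\bar{i}_m,q}=\sum_{n=1}^{\infty}\frac{H_n^{(i_1)}\cdots H_n^{(i_l)}\bar{H}_n^{(i_{l+1})}\cdots\bar{H}_n^{(i_m)}}{n^q}.$$ Alternating multiple zeta values: for positive integers $s_j$ and signs $\sigma_j=\pm1$ with $(s_1,\sigma_1)\neq(1,1)$, $$\zeta(s_1,\ldots,s_k;\sigma_1,\ldots,\sigma_k)=\lim_{n\to\infty}\sum_{n\geq n_1>n_2>\cdots>n_k\geq 1}\frac{\sigma_1^{n_1}\cdots\sigma_k^{n_k}}{n_1^{s_1}\cdots n_k^{s_k}}.$$ The exponents and signs are combined into a single string, with $s_j$ in the $j$th position when $\sigma_j=+1$ and $\bar{s}_j$ (or $\overline{s_j}$) in the $j$th position when $\sigma_j=-1$; e.g. $\zeta(\bar{s}_1,s_2)=\zeta(s_1,s_2;-1,1)$. $\chi_{\mathbb{N}}$ is the characteristic function of the set of positive integers: $\chi_{\mathbb{N}}(x)=1$ if $x$ is a positive integer and $0$ otherwise. $\mathcal{S}_m$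 is the symmetric group on $\{1,\ldots,m\}$; a composition of $m$ is an ordered tuple of positive integers summing to $m$, and $\mathcal{C}_m$ is the set of all compositions of $m$. For $c=1$, the empty sum $\theta_1+\cdots+\theta_{c-1}$ is $0$. -}

module Defs where

open import Data.Bool.Base using (true; false; if_then_else_)
open import Data.Empty using (⊥-elim)
open import Data.Fin.Base as Fin using (Fin; zero; suc; toℕ; punchIn)
open import Data.Fin.Permutation as Perm using (Permutation′; _⟨$⟩ʳ_; insert; remove)
open import Data.Fin.Properties using (punchIn-injective)
open import Data.Integer.Base as ℤ using (ℤ; +_; -[1+_]; -1ℤ; _◃_)
import Data.Integer.Properties as ℤₚ
open import Data.List.Base as List using (List; []; _∷_; _++_; foldr; concatMap; allFin)
open import Data.List.Membership.Propositional using (_∈_)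
open import Data.List.Membership.Propositional.Properties
  using (∈-++⁺ˡ; ∈-++⁺ʳ; ∈-map⁺; ∈-map⁻; ∈-concatMap⁺; ∈-allFin)
open import Data.List.Relation.Unary.All as All using (All; []; _∷_)
import Data.List.Relation.Unary.All.Properties as Allₚ
open import Data.List.Relation.Unary.AllPairs using (AllPairs; []; _∷_)
import Data.List.Relation.Unary.AllPairs as AllPairs
import Data.List.Relation.Unary.AllPairs.Properties as AllPairsₚ
open import Data.List.Relation.Unary.Any as Any using (Any; here; there)
import Data.List.Relation.Unary.Any.Properties as Anyₚ
open import Data.List.Relation.Unary.Unique.Propositional using (Unique)
import Data.List.Relation.Unary.Unique.Propositional.Properties as Uniqueₚ
open import Data.Nat.Base as ℕ using (ℕ; zero; suc; z≤n; s≤s; NonZero; _!; parity; _<ᵇ_)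
import Data.Nat.ListAction as ℕ
import Data.Nat.Properties as ℕₚ
open import Data.Parity.Base using (toSign)
open import Data.Product.Base using (∃; _×_; _,_; proj₁; proj₂)
open import Data.Rational.Base
  using (ℚ; mkℚ; 0ℚ; 1ℚ; ½; _/_; _+_; _*_; _-_; -_; 1/_; ∣_∣; _≤_; _<_; *<*;
         Positive; NonNegative; positive; nonNegative; toℚᵘ; *-1-rawMonoid)
open import Data.Rational.Properties as ℚₚ
  using (≤-refl; ≤-trans; ≤-reflexive; <⇒≤; +-mono-≤; +-mono-<; module ≤-Reasoning)
open import Data.Rational.Solver using (module +-*-Solver)
import Data.Rational.Unnormalised.Base as ℚᵘ
import Data.Rational.Unnormalised.Properties as ℚᵘₚ
open import Data.Sign.Base as Sign using (Sign)
open import Data.Sum.Base using (_⊎_; inj₁; inj₂)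
open import Data.Vec.Base as Vec using (Vec; []; _∷_; tabulate)
open import Data.Vec.Functional using (Vector)
open import Function.Base using (_∘_)
open import Relation.Binary.PropositionalEquality
  using (_≡_; _≢_; refl; sym; trans; cong; cong₂; subst)
open import Relation.Nullary.Negation using (¬_)
open import Algebra.Definitions.RawMonoid *-1-rawMonoid using () renaming (sum to ∏)

_⟶0 : (ℕ → ℚ) → Set
x ⟶0 = ∀ ε → 0ℚ < ε → ∃ λ N → ∀ n → N ℕ.≤ n → ∣ x n ∣ < ε

Cauchy : (ℕ → ℚ) → Set
Cauchy x = ∀ ε → 0ℚ < ε → ∃ λ N → ∀ a b → N ℕ.≤ a → N ℕ.≤ b → ∣ x a - x b ∣ < ε

-- Cauchy sequences of rationals, compared by _≃_ below.  In this model the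
-- limit of a convergent sequence x of rationals is the real represented by
-- x itself.
record ℝ : Set where
  constructor lim
  field
    seq    : ℕ → ℚ
    cauchy : Cauchy seq

open ℝ public

infix 4 _≃_

_≃_ : ℝ → ℝ → Set
x ≃ y = (λ n → seq x n - seq y n) ⟶0

module Sequences where

  open +-*-Solver

  0<½*_ : ∀ {ε} → 0ℚ < ε → 0ℚ < ½ * ε
  0<½*_ {ε} 0<ε = ℚₚ.positive⁻¹ (½ * ε) {{ℚₚ.pos*pos⇒pos ½ ε {{positive 0<ε}}}}

  halves : ∀ ε → ½ * ε + ½ * ε ≡ ε
  halves = solve 1 (λ ε → con ½ :* ε :+ con ½ :* ε := ε) refl

  ∣-∣-swap : ∀ p q → ∣ p - q ∣ ≡ ∣ q - p ∣
  ∣-∣-swap p q = trans (cong ∣_∣ (solve 2 (λ p q → p :- q := :- (q :- p)) refl p q))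
                       (ℚₚ.∣-p∣≡∣p∣ (q - p))

  0≤⇒nonNeg : ∀ {p} → 0ℚ ≤ p → NonNegative p
  0≤⇒nonNeg = nonNegative

  p≤∣p∣ : ∀ p → p ≤ ∣ p ∣
  p≤∣p∣ p with ℚₚ.≤-total 0ℚ p
  ... | inj₁ 0≤p = ≤-reflexive (sym (ℚₚ.0≤p⇒∣p∣≡p 0≤p))
  ... | inj₂ p≤0 = ≤-trans p≤0 (ℚₚ.0≤∣p∣ p)

  *-mono : ∀ {p q r s} → 0ℚ ≤ q → 0ℚ ≤ r → p ≤ q → r ≤ s → p * r ≤ q * s
  *-mono {p} {q} {r} {s} 0≤q 0≤r p≤q r≤s =
    ≤-trans (ℚₚ.*-monoʳ-≤-nonNeg r {{nonNegative 0≤r}} p≤q)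
            (ℚₚ.*-monoˡ-≤-nonNeg q {{nonNegative 0≤q}} r≤s)

  0≤* : ∀ {p q} → 0ℚ ≤ p → 0ℚ ≤ q → 0ℚ ≤ p * q
  0≤* {p} {q} 0≤p 0≤q = ℚₚ.nonNegative⁻¹ (p * q)
    {{ℚₚ.nonNeg*nonNeg⇒nonNeg p {{nonNegative 0≤p}} q {{nonNegative 0≤q}}}}

  0≤+ : ∀ {p q} → 0ℚ ≤ p → 0ℚ ≤ q → 0ℚ ≤ p + q
  0≤+ = +-mono-≤ {0ℚ} {_} {0ℚ}

  ⟶0-≤ : ∀ {x y} → (∀ n → ∣ x n ∣ ≤ ∣ y n ∣) → y ⟶0 → x ⟶0
  ⟶0-≤ x≤y y⟶0 ε 0<ε = proj₁ (y⟶0 ε 0<ε) ,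
    λ n N≤n → ℚₚ.≤-<-trans (x≤y n) (proj₂ (y⟶0 ε 0<ε) n N≤n)

  ⟶0-+ : ∀ {x y} → x ⟶0 → y ⟶0 → (λ n → x n + y n) ⟶0
  ⟶0-+ {x} {y} x⟶0 y⟶0 ε 0<ε with x⟶0 _ (0<½* 0<ε) | y⟶0 _ (0<½* 0<ε)
  ... | M , xM | N , yN = M ℕ.⊔ N , λ n MN≤n → begin-strict
    ∣ x n + y n ∣       ≤⟨ ℚₚ.∣p+q∣≤∣p∣+∣q∣ (x n) (y n) ⟩
    ∣ x n ∣ + ∣ y n ∣   <⟨ +-mono-< (xM n (ℕₚ.m⊔n≤o⇒m≤o M N MN≤n))
                                   (yN n (ℕₚ.m⊔n≤o⇒n≤o M N MN≤n)) ⟩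
    ½ * ε + ½ * ε       ≡⟨ halves ε ⟩
    ε                   ∎
    where open ≤-Reasoning

  -- multiplication by c shrinks to ε what is below ε/(|c|+1)
  module Scale (c ε : ℚ) (0<ε : 0ℚ < ε) where
    instance
      k-pos : Positive (∣ c ∣ + 1ℚ)
      k-pos = ℚₚ.nonNeg+pos⇒pos ∣ c ∣ {{ℚₚ.∣-∣-nonNeg c}} 1ℚ

      k-nz : Data.Rational.Base.NonZero (∣ c ∣ + 1ℚ)
      k-nz = ℚₚ.pos⇒nonZero (∣ c ∣ + 1ℚ)

      ε-pos : Positive ε
      ε-pos = positive 0<ε

    δ : ℚ
    δ = 1/ (∣ c ∣ + 1ℚ) * ε

    0<δ : 0ℚ < δ
    0<δ = ℚₚ.positive⁻¹ δ {{ℚₚ.pos*pos⇒pos (1/ (∣ c ∣ + 1ℚ)) {{ℚₚ.1/pos⇒pos (∣ c ∣ + 1ℚ)}} ε}}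

    shrink : ∀ {p} → ∣ p ∣ < δ → ∣ c * p ∣ < ε
    shrink {p} p<δ = begin-strict
      ∣ c * p ∣                                  ≡⟨ ℚₚ.∣p*q∣≡∣p∣*∣q∣ c p ⟩
      ∣ c ∣ * ∣ p ∣                              ≤⟨ ℚₚ.*-monoʳ-≤-nonNeg ∣ p ∣ {{ℚₚ.∣-∣-nonNeg p}}
                                                     (≤-trans (≤-reflexive (sym (ℚₚ.+-identityʳ ∣ c ∣)))
                                                       (ℚₚ.+-monoʳ-≤ ∣ c ∣ (ℚₚ.nonNegative⁻¹ 1ℚ))) ⟩
      (∣ c ∣ + 1ℚ) * ∣ p ∣                       <⟨ ℚₚ.*-monoʳ-<-pos (∣ c ∣ + 1ℚ) p<δ ⟩
      (∣ c ∣ + 1ℚ) * (1/ (∣ c ∣ + 1ℚ) * ε)       ≡⟨ sym (ℚₚ.*-assoc (∣ c ∣ + 1ℚ) _ ε) ⟩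
      (∣ c ∣ + 1ℚ) * (1/ (∣ c ∣ + 1ℚ)) * ε       ≡⟨ cong (_* ε) (ℚₚ.*-inverseʳ (∣ c ∣ + 1ℚ)) ⟩
      1ℚ * ε                                     ≡⟨ ℚₚ.*-identityˡ ε ⟩
      ε                                          ∎
      where open ≤-Reasoning

  ⟶0-* : ∀ c {x} → x ⟶0 → (λ n → c * x n) ⟶0
  ⟶0-* c x⟶0 ε 0<ε = proj₁ (x⟶0 δ 0<δ) , λ n N≤n → shrink (proj₂ (x⟶0 δ 0<δ) n N≤n)
    where open Scale c ε 0<ε

  cauchy-const : ∀ c → Cauchy (λ _ → c)
  cauchy-const c ε 0<ε = 0 , λ _ _ _ _ → subst (_< ε) (cong ∣_∣ (sym (ℚₚ.+-inverseʳ c))) 0<ε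

  cauchy-+ : ∀ {x y} → Cauchy x → Cauchy y → Cauchy (λ n → x n + y n)
  cauchy-+ {x} {y} cx cy ε 0<ε with cx _ (0<½* 0<ε) | cy _ (0<½* 0<ε)
  ... | M , xM | N , yN = M ℕ.⊔ N , λ a b a≥ b≥ → begin-strict
    ∣ (x a + y a) - (x b + y b) ∣
      ≡⟨ cong ∣_∣ (solve 4 (λ p q r s → (p :+ q) :- (r :+ s) := (p :- r) :+ (q :- s)) refl
                     (x a) (y a) (x b) (y b)) ⟩
    ∣ (x a - x b) + (y a - y b) ∣
      ≤⟨ ℚₚ.∣p+q∣≤∣p∣+∣q∣ (x a - x b) (y a - y b) ⟩
    ∣ x a - x b ∣ + ∣ y a - y b ∣
      <⟨ +-mono-< (xM a b (ℕₚ.m⊔n≤o⇒m≤o M N a≥) (ℕₚ.m⊔n≤o⇒m≤o M N b≥))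
                  (yN a b (ℕₚ.m⊔n≤o⇒n≤o M N a≥) (ℕₚ.m⊔n≤o⇒n≤o M N b≥)) ⟩
    ½ * ε + ½ * ε
      ≡⟨ halves ε ⟩
    ε ∎
    where open ≤-Reasoning

  cauchy-* : ∀ c {x} → Cauchy x → Cauchy (λ n → c * x n)
  cauchy-* c {x} cx ε 0<ε = proj₁ (cx δ 0<δ) , λ a b a≥ b≥ →
    subst (_< ε) (cong ∣_∣ (solve 3 (λ c p q → c :* (p :- q) := c :* p :- c :* q) refl c (x a) (x b)))
      (shrink (proj₂ (cx δ 0<δ) a b a≥ b≥))
    where open Scale c ε 0<ε

  cauchy-⟶0 : ∀ {x} → x ⟶0 → Cauchy x
  cauchy-⟶0 {x} x⟶0 ε 0<ε with x⟶0 _ (0<½* 0<ε)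
  ... | N , xN = N , λ a b a≥ b≥ → begin-strict
    ∣ x a - x b ∣       ≤⟨ ℚₚ.∣p-q∣≤∣p∣+∣q∣ (x a) (x b) ⟩
    ∣ x a ∣ + ∣ x b ∣   <⟨ +-mono-< (xN a a≥) (xN b b≥) ⟩
    ½ * ε + ½ * ε       ≡⟨ halves ε ⟩
    ε                   ∎
    where open ≤-Reasoning

  cauchy-cong : ∀ {x y} → (∀ n → x n ≡ y n) → Cauchy x → Cauchy y
  cauchy-cong x≡y cx ε 0<ε = proj₁ (cx ε 0<ε) , λ a b a≥ b≥ →
    subst (_< ε) (cong₂ (λ p q → ∣ p - q ∣) (x≡y a) (x≡y b)) (proj₂ (cx ε 0<ε) a b a≥ b≥)

  -- telescoping majorant: Σ |xₙ₊₁ - xₙ| ≤ Σ (Bₙ - Bₙ₊₁) < ∞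
  cauchy-telescope : ∀ {x : ℕ → ℚ} (B : ℕ → ℚ) → (∀ n → 0ℚ ≤ B n) → B ⟶0 →
                     (∀ n → ∣ x (suc n) - x n ∣ ≤ B n - B (suc n)) → Cauchy x
  cauchy-telescope {x} B 0≤B B⟶0 step ε 0<ε with B⟶0 ε 0<ε
  ... | N , BN = N , close
    where
    open ≤-Reasoning

    steps : ∀ n d → ∣ x (d ℕ.+ n) - x n ∣ ≤ B n - B (d ℕ.+ n)
    steps n zero = ≤-reflexive (trans (cong ∣_∣ (ℚₚ.+-inverseʳ (x n))) (sym (ℚₚ.+-inverseʳ (B n))))
    steps n (suc d) = begin
      ∣ x (suc (d ℕ.+ n)) - x n ∣
        ≡⟨ cong ∣_∣ (solve 3 (λ p q r → p :- r := (p :- q) :+ (q :- r)) refl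
                       (x (suc (d ℕ.+ n))) (x (d ℕ.+ n)) (x n)) ⟩
      ∣ (x (suc (d ℕ.+ n)) - x (d ℕ.+ n)) + (x (d ℕ.+ n) - x n) ∣
        ≤⟨ ℚₚ.∣p+q∣≤∣p∣+∣q∣ (x (suc (d ℕ.+ n)) - x (d ℕ.+ n)) (x (d ℕ.+ n) - x n) ⟩
      ∣ x (suc (d ℕ.+ n)) - x (d ℕ.+ n) ∣ + ∣ x (d ℕ.+ n) - x n ∣
        ≤⟨ +-mono-≤ (step (d ℕ.+ n)) (steps n d) ⟩
      (B (d ℕ.+ n) - B (suc (d ℕ.+ n))) + (B n - B (d ℕ.+ n))
        ≡⟨ solve 3 (λ p q r → (q :- p) :+ (r :- q) := r :- p) refl
             (B (suc (d ℕ.+ n))) (B (d ℕ.+ n)) (B n) ⟩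
      B n - B (suc (d ℕ.+ n)) ∎

    close′ : ∀ a b → N ℕ.≤ a → a ℕ.≤ b → ∣ x b - x a ∣ < ε
    close′ a b a≥ a≤b = begin-strict
      ∣ x b - x a ∣                     ≡⟨ cong (λ c → ∣ x c - x a ∣) (sym (ℕₚ.m∸n+n≡m a≤b)) ⟩
      ∣ x (b ℕ.∸ a ℕ.+ a) - x a ∣       ≤⟨ steps a (b ℕ.∸ a) ⟩
      B a - B (b ℕ.∸ a ℕ.+ a)           ≤⟨ ℚₚ.+-monoʳ-≤ (B a) (ℚₚ.neg-antimono-≤ (0≤B _)) ⟩
      B a + 0ℚ                          ≡⟨ ℚₚ.+-identityʳ (B a) ⟩
      B a                               ≡⟨ sym (ℚₚ.0≤p⇒∣p∣≡p (0≤B a)) ⟩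
      ∣ B a ∣                           <⟨ BN a a≥ ⟩
      ε                                 ∎

    close : ∀ a b → N ℕ.≤ a → N ℕ.≤ b → ∣ x a - x b ∣ < ε
    close a b a≥ b≥ with ℕₚ.≤-total a b
    ... | inj₁ a≤b = subst (_< ε) (∣-∣-swap (x b) (x a)) (close′ a b a≥ a≤b)
    ... | inj₂ b≤a = close′ b a b≥ b≤a

infixr 5 ∑
infixl 6 _+ℝ_
infixr 7 _·_

0ℝ : ℝ
0ℝ = lim (λ _ → 0ℚ) (Sequences.cauchy-const 0ℚ)

_+ℝ_ : ℝ → ℝ → ℝ
x +ℝ y = lim (λ n → seq x n + seq y n) (Sequences.cauchy-+ {seq x} {seq y} (cauchy x) (cauchy y))

_·_ : ℚ → ℝ → ℝ
c · x = lim (λ n → c * seq x n) (Sequences.cauchy-* c {seq x} (cauchy x))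

∑ : ∀ {A : Set} → List A → (A → ℝ) → ℝ
∑ xs f = foldr (λ a s → f a +ℝ s) 0ℝ xs

syntax ∑ xs (λ a → e) = ∑[ a ∈ xs ] e

infixr 5 ∑<

∑< : ℕ → (ℕ → ℚ) → ℚ
∑< zero    f = 0ℚ
∑< (suc n) f = ∑< n f + f n

syntax ∑< n (λ k → e) = ∑[ k < n ] e

infixl 7.5 _/suc_^_

_/suc_^_ : ℤ → ℕ → ℕ → ℚ
z /suc k ^ r = (z / suc k ℕ.^ r) {{ℕₚ.m^n≢0 (suc k) r}}

-- A summation index that runs over 1, …, n is written suc k with k < n.

H : (r n : ℕ) → ℚ
H r n = ∑[ k < n ] + 1 /suc k ^ r

H̄ : (r n : ℕ) → ℚ
H̄ r n = ∑[ k < n ] (-1ℤ ℤ.^ k) /suc k ^ r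

-- One entry of the argument string of ζ; the sign − is the overline.
record Entry : Set where
  constructor ⟨_,_⟩
  field
    exponent    : ℕ
    sign        : Sign
    .{{nonZero}} : NonZero exponent

open Entry public

_^ˢ_ : Sign → ℕ → ℤ
σ ^ˢ n = (σ ◃ 1) ℤ.^ n

-- The sum over n ≥ n₁ > n₂ > ⋯ ≥ 1, nested: for n₁ = suc k the remaining
-- indices satisfy k ≥ n₂ > ⋯ ≥ 1.
ζ≤ : List Entry → ℕ → ℚ
ζ≤ []      n = 1ℚ
ζ≤ (a ∷ w) n = ∑[ k < n ] ((sign a ^ˢ suc k) /suc k ^ exponent a * ζ≤ w k)

module Convergence where

  open Sequences
  open +-*-Solver

  r : ℕ → ℚ
  r n = + 1 / suc n

  0≤r : ∀ n → 0ℚ ≤ r n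
  0≤r n = ℚₚ.nonNegative⁻¹ (r n) {{ℚₚ.normalize-nonNeg 1 (suc n)}}

  1/-anti : ∀ d e .{{_ : NonZero d}} .{{_ : NonZero e}} → e ℕ.≤ d → + 1 / d ≤ + 1 / e
  1/-anti (suc d) (suc e) e≤d = ℚₚ.toℚᵘ-cancel-≤
    (ℚᵘₚ.≤-respˡ-≃ (ℚᵘₚ.≃-sym (ℚₚ.toℚᵘ-fromℚᵘ (ℚᵘ.mkℚᵘ (+ 1) d)))
    (ℚᵘₚ.≤-respʳ-≃ (ℚᵘₚ.≃-sym (ℚₚ.toℚᵘ-fromℚᵘ (ℚᵘ.mkℚᵘ (+ 1) e)))
    (ℚᵘ.*≤* (ℤₚ.*-monoˡ-≤-nonNeg (+ 1) (ℤ.+≤+ e≤d)))))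

  r-anti : ∀ n → r (suc n) ≤ r n
  r-anti n = 1/-anti (suc (suc n)) (suc n) (ℕₚ.n≤1+n (suc n))

  r≤1 : ∀ n → r n ≤ 1ℚ
  r≤1 n = 1/-anti (suc n) 1 (s≤s z≤n)

  u : ∀ n → toℚᵘ (r n) ℚᵘ.≃ ℚᵘ.mkℚᵘ (+ 1) n
  u n = ℚₚ.toℚᵘ-fromℚᵘ (ℚᵘ.mkℚᵘ (+ 1) n)

  r-diff : ∀ n → r n * r (suc n) ≡ r n - r (suc n)
  r-diff n = ℚₚ.toℚᵘ-injective (begin
    toℚᵘ (r n * r (suc n))          ≈⟨ ℚₚ.toℚᵘ-homo-* (r n) (r (suc n)) ⟩
    toℚᵘ (r n) ℚᵘ.* toℚᵘ (r (suc n)) ≈⟨ ℚᵘₚ.*-cong (u n) (u (suc n)) ⟩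
    ℚᵘ.mkℚᵘ (+ 1) n ℚᵘ.* ℚᵘ.mkℚᵘ (+ 1) (suc n) ≈⟨ ℚᵘ.*≡* (cong (ℤ._* + (suc n ℕ.* suc (suc n))) (sym (num (+ suc n)))) ⟩
    ℚᵘ.mkℚᵘ (+ 1) n ℚᵘ.+ ℚᵘ.- ℚᵘ.mkℚᵘ (+ 1) (suc n) ≈⟨ ℚᵘₚ.+-cong (u n) (ℚᵘₚ.-‿cong (u (suc n))) ⟨
    toℚᵘ (r n) ℚᵘ.+ ℚᵘ.- toℚᵘ (r (suc n)) ≈⟨ ℚᵘₚ.+-congʳ (toℚᵘ (r n)) (ℚₚ.toℚᵘ-homo‿- (r (suc n))) ⟨
    toℚᵘ (r n) ℚᵘ.+ toℚᵘ (- r (suc n)) ≈⟨ ℚₚ.toℚᵘ-homo-+ (r n) (- r (suc n)) ⟨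
    toℚᵘ (r n - r (suc n)) ∎)
    where
    open ℚᵘₚ.≃-Reasoning
    num : ∀ k → + 1 ℤ.* (+ 1 ℤ.+ k) ℤ.+ -1ℤ ℤ.* k ≡ + 1
    num k = trans (cong₂ ℤ._+_ (ℤₚ.*-identityˡ (+ 1 ℤ.+ k)) (ℤₚ.-1*i≡-i k))
           (trans (ℤₚ.+-assoc (+ 1) k (ℤ.- k)) (cong (ℤ._+_ (+ 1)) (ℤₚ.+-inverseʳ k)))


  r⟶0 : r ⟶0
  r⟶0 ε@(mkℚ (+ suc a) d _) 0<ε = suc d , λ n d<n → ℚₚ.≤-<-trans
    (≤-trans (≤-reflexive (ℚₚ.0≤p⇒∣p∣≡p (0≤r n))) (1/-anti (suc n) (suc (suc d)) (s≤s d<n)))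
    (ℚₚ.toℚᵘ-cancel-< (ℚᵘₚ.<-respˡ-≃ (ℚᵘₚ.≃-sym (ℚₚ.toℚᵘ-fromℚᵘ (ℚᵘ.mkℚᵘ (+ 1) (suc d))))
      (ℚᵘ.*<* (ℤ.+<+ (s≤s (ℕₚ.≤-trans (ℕₚ.≤-reflexive (cong suc (ℕₚ.+-identityʳ d))) (ℕₚ.m≤m+n (suc d) _)))))))
  r⟶0 (mkℚ (+ zero) d _)  (*<* (ℤ.+<+ ()))
  r⟶0 (mkℚ -[1+ a ] d _) (*<* ())

  r-square : ∀ n → + 1 / (suc n ℕ.* suc n) ≡ r n * r n
  r-square n = ℚₚ.toℚᵘ-injective (begin
    toℚᵘ (+ 1 / (suc n ℕ.* suc n))               ≈⟨ u (n ℕ.+ n ℕ.* suc n) ⟩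
    ℚᵘ.mkℚᵘ (+ 1) (n ℕ.+ n ℕ.* suc n)            ≈⟨ ℚᵘₚ.*-cong (u n) (u n) ⟨
    toℚᵘ (r n) ℚᵘ.* toℚᵘ (r n)                   ≈⟨ ℚₚ.toℚᵘ-homo-* (r n) (r n) ⟨
    toℚᵘ (r n * r n)                             ∎)
    where open ℚᵘₚ.≃-Reasoning

  -- h n is the n-th harmonic number and Q k n its k-th power
  h : ℕ → ℚ
  h n = ∑[ k < n ] r k

  0≤h : ∀ n → 0ℚ ≤ h n
  0≤h zero    = ≤-refl
  0≤h (suc n) = 0≤+ (0≤h n) (0≤r n)

  h-mono : ∀ n → h n ≤ h (suc n)
  h-mono n = ≤-trans (≤-reflexive (sym (ℚₚ.+-identityʳ (h n)))) (ℚₚ.+-monoʳ-≤ (h n) (0≤r n))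

  1≤h : ∀ n → 1ℚ ≤ h (suc n)
  1≤h zero    = ≤-refl
  1≤h (suc n) = ≤-trans (1≤h n) (h-mono (suc n))

  Q : ℕ → ℕ → ℚ
  Q zero    n = 1ℚ
  Q (suc k) n = h n * Q k n

  0≤Q : ∀ k n → 0ℚ ≤ Q k n
  0≤Q zero    n = ℚₚ.nonNegative⁻¹ 1ℚ
  0≤Q (suc k) n = 0≤* (0≤h n) (0≤Q k n)

  Q-mono : ∀ k n → Q k n ≤ Q k (suc n)
  Q-mono zero    n = ≤-refl
  Q-mono (suc k) n = *-mono (0≤h (suc n)) (0≤Q k n) (h-mono n) (Q-mono k n)

  P : ℕ → ℕ → ℚ
  P k n = Q k (suc n)

  0≤P : ∀ k n → 0ℚ ≤ P k n
  0≤P k n = 0≤Q k (suc n)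

  P-suc : ∀ k n → P k n ≤ P (suc k) n
  P-suc k n = ≤-trans (≤-reflexive (sym (ℚₚ.*-identityˡ (P k n))))
    (ℚₚ.*-monoʳ-≤-nonNeg (P k n) {{0≤⇒nonNeg (0≤P k n)}} (1≤h n))

  2ℚ : ℚ
  2ℚ = 1ℚ + 1ℚ

  0≤2 : 0ℚ ≤ 2ℚ
  0≤2 = ℚₚ.nonNegative⁻¹ 2ℚ

  D C : ℕ → ℚ
  D zero    = 1ℚ
  D (suc k) = 2ℚ * D k
  C zero    = 1ℚ
  C (suc k) = C k + D (suc k)

  0≤D : ∀ k → 0ℚ ≤ D k
  0≤D zero    = ℚₚ.nonNegative⁻¹ 1ℚ
  0≤D (suc k) = 0≤* 0≤2 (0≤D k)

  0≤C : ∀ k → 0ℚ ≤ C k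
  0≤C zero    = ℚₚ.nonNegative⁻¹ 1ℚ
  0≤C (suc k) = 0≤+ (0≤C k) (0≤D (suc k))

  open ≤-Reasoning

  P-double : ∀ k n → P k (suc n) ≤ D k * P k n
  P-double zero    n = ≤-refl
  P-double (suc k) n = begin
    (h (suc n) + r (suc n)) * P k (suc n)
      ≤⟨ *-mono (0≤+ (0≤h (suc n)) (0≤h (suc n))) (0≤P k (suc n))
           (ℚₚ.+-monoʳ-≤ (h (suc n)) (≤-trans (r≤1 (suc n)) (1≤h n))) (P-double k n) ⟩
    (h (suc n) + h (suc n)) * (D k * P k n)
      ≡⟨ solve 3 (λ g d p → (g :+ g) :* (d :* p) := (con 2ℚ :* d) :* (g :* p)) refl
           (h (suc n)) (D k) (P k n) ⟩
    2ℚ * D k * (h (suc n) * P k n) ∎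

  P-step : ∀ k n → P (suc k) (suc n) ≤ P (suc k) n + C k * (P k n * r (suc n))
  P-step zero n = ≤-reflexive
    (solve 2 (λ g ρ → (g :+ ρ) :* con 1ℚ := g :* con 1ℚ :+ con 1ℚ :* (con 1ℚ :* ρ)) refl
       (h (suc n)) (r (suc n)))
  P-step (suc k) n = begin
    (g + ρ) * P (suc k) (suc n)
      ≡⟨ ℚₚ.*-distribʳ-+ (P (suc k) (suc n)) g ρ ⟩
    g * P (suc k) (suc n) + ρ * P (suc k) (suc n)
      ≤⟨ +-mono-≤ (ℚₚ.*-monoˡ-≤-nonNeg g {{0≤⇒nonNeg (0≤h (suc n))}} (P-step k n))
                  (ℚₚ.*-monoˡ-≤-nonNeg ρ {{0≤⇒nonNeg (0≤r (suc n))}} (P-double (suc k) n)) ⟩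
    g * (g * P k n + C k * (P k n * ρ)) + ρ * (D (suc k) * (g * P k n))
      ≡⟨ solve 5 (λ g ρ p c d → g :* (g :* p :+ c :* (p :* ρ)) :+ ρ :* (d :* (g :* p)) :=
                                g :* (g :* p) :+ (c :+ d) :* ((g :* p) :* ρ)) refl
           g ρ (P k n) (C k) (D (suc k)) ⟩
    g * (g * P k n) + (C k + D (suc k)) * ((g * P k n) * ρ) ∎
    where
    g = h (suc n)
    ρ = r (suc n)

  ν : ℕ → ℚ
  ν zero    = 0ℚ
  ν (suc n) = 1ℚ + ν n

  ν-r : ∀ n → ν (suc n) * r n ≡ 1ℚ
  ν-r zero    = refl
  ν-r (suc n) = begin-equality
    (1ℚ + v) * r′                   ≡⟨ solve 2 (λ v r′ → (con 1ℚ :+ v) :* r′ := con 1ℚ :* r′ :+ v :* r′) refl v r′ ⟩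
    1ℚ * r′ + v * r′                ≡⟨ cong (λ t → t * r′ + v * r′) (sym (ν-r n)) ⟩
    v * r n * r′ + v * r′           ≡⟨ cong (_+ v * r′) (ℚₚ.*-assoc v (r n) r′) ⟩
    v * (r n * r′) + v * r′         ≡⟨ cong (λ t → v * t + v * r′) (r-diff n) ⟩
    v * (r n - r′) + v * r′         ≡⟨ solve 3 (λ v p q → v :* (p :- q) :+ v :* q := v :* p) refl v (r n) r′ ⟩
    v * r n                         ≡⟨ ν-r n ⟩
    1ℚ                              ∎
    where
    v  = ν (suc n)
    r′ = r (suc n)

  ν-mono : ∀ d e → ν d ≤ ν (d ℕ.+ e)
  ν-mono zero    zero    = ≤-refl
  ν-mono zero    (suc e) = 0≤+ (ℚₚ.nonNegative⁻¹ 1ℚ) (ν-mono zero e)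
  ν-mono (suc d) e       = ℚₚ.+-monoʳ-≤ 1ℚ (ν-mono d e)

  -- a sequence whose increments tend to 0 is o(n)
  cesàro : (p z : ℕ → ℚ) → (∀ n → 0ℚ ≤ p n) → (∀ n → p (suc n) ≤ p n + z n) → z ⟶0 →
           (λ n → p n * r n) ⟶0
  cesàro p z 0≤p step z⟶0 ε 0<ε with z⟶0 _ (0<½* 0<ε)
  ... | M , zM with ⟶0-* (p M) r⟶0 _ (0<½* 0<ε)
  ... | N , rN = M ℕ.⊔ N , bound
    where
    η = ½ * ε

    grow : ∀ d → p (d ℕ.+ M) ≤ p M + ν d * η
    grow zero    = ≤-reflexive (solve 2 (λ a b → a := a :+ con 0ℚ :* b) refl (p M) η)
    grow (suc d) = begin
      p (suc (d ℕ.+ M))            ≤⟨ step (d ℕ.+ M) ⟩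
      p (d ℕ.+ M) + z (d ℕ.+ M)    ≤⟨ +-mono-≤ (grow d) (≤-trans (p≤∣p∣ (z (d ℕ.+ M)))
                                        (<⇒≤ (zM (d ℕ.+ M) (ℕₚ.m≤n+m M d)))) ⟩
      p M + ν d * η + η            ≡⟨ solve 3 (λ a v e → a :+ v :* e :+ e := a :+ (con 1ℚ :+ v) :* e) refl (p M) (ν d) η ⟩
      p M + (1ℚ + ν d) * η         ∎

    ν-r≤1 : ∀ d → ν d * r (d ℕ.+ M) ≤ 1ℚ
    ν-r≤1 d = ≤-trans
      (ℚₚ.*-monoʳ-≤-nonNeg (r (d ℕ.+ M)) {{0≤⇒nonNeg (0≤r (d ℕ.+ M))}}
        (subst (λ e → ν d ≤ ν e) (ℕₚ.+-suc d M) (ν-mono d (suc M))))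
      (≤-reflexive (ν-r (d ℕ.+ M)))

    bound′ : ∀ d → N ℕ.≤ d ℕ.+ M → ∣ p (d ℕ.+ M) * r (d ℕ.+ M) ∣ < ε
    bound′ d N≤ = begin-strict
      ∣ p n * r n ∣                     ≡⟨ ℚₚ.0≤p⇒∣p∣≡p (0≤* (0≤p n) (0≤r n)) ⟩
      p n * r n                         ≤⟨ ℚₚ.*-monoʳ-≤-nonNeg (r n) {{0≤⇒nonNeg (0≤r n)}} (grow d) ⟩
      (p M + ν d * η) * r n             ≡⟨ solve 4 (λ a v e ρ → (a :+ v :* e) :* ρ := a :* ρ :+ v :* ρ :* e) refl (p M) (ν d) η (r n) ⟩
      p M * r n + ν d * r n * η         <⟨ ℚₚ.+-mono-<-≤
                                             (ℚₚ.≤-<-trans (p≤∣p∣ (p M * r n)) (rN n N≤))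
                                             (ℚₚ.*-monoʳ-≤-nonNeg η {{0≤⇒nonNeg (<⇒≤ (0<½* 0<ε))}} (ν-r≤1 d)) ⟩
      η + 1ℚ * η                        ≡⟨ solve 1 (λ ε → con ½ :* ε :+ con 1ℚ :* (con ½ :* ε) := ε) refl ε ⟩
      ε                                 ∎
      where n = d ℕ.+ M

    bound : ∀ n → M ℕ.⊔ N ℕ.≤ n → ∣ p n * r n ∣ < ε
    bound n MN≤n = subst (λ k → ∣ p k * r k ∣ < ε) n≡
      (bound′ (n ℕ.∸ M) (subst (N ℕ.≤_) (sym n≡) (ℕₚ.m⊔n≤o⇒n≤o M N MN≤n)))
      where n≡ = ℕₚ.m∸n+n≡m (ℕₚ.m⊔n≤o⇒m≤o M N MN≤n)

  y : ℕ → ℕ → ℚ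
  y k n = P k n * r n

  0≤y : ∀ k n → 0ℚ ≤ y k n
  0≤y k n = 0≤* (0≤P k n) (0≤r n)

  y⟶0 : ∀ k → y k ⟶0
  y⟶0 zero    = ⟶0-* 1ℚ r⟶0
  y⟶0 (suc k) = cesàro (P (suc k)) (λ n → C k * y k n) (0≤P (suc k)) step (⟶0-* (C k) (y⟶0 k))
    where
    step : ∀ n → P (suc k) (suc n) ≤ P (suc k) n + C k * y k n
    step n = ≤-trans (P-step k n) (ℚₚ.+-monoʳ-≤ (P (suc k) n)
      (ℚₚ.*-monoˡ-≤-nonNeg (C k) {{0≤⇒nonNeg (0≤C k)}}
        (ℚₚ.*-monoˡ-≤-nonNeg (P k n) {{0≤⇒nonNeg (0≤P k n)}} (r-anti n))))

  -- B k n majorises the tail from n on of Σ P k n (rₙ - rₙ₊₁)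
  B : ℕ → ℕ → ℚ
  B zero    n = y zero n
  B (suc k) n = y (suc k) n + C k * B k n

  0≤B : ∀ k n → 0ℚ ≤ B k n
  0≤B zero    n = 0≤y zero n
  0≤B (suc k) n = 0≤+ (0≤y (suc k) n) (0≤* (0≤C k) (0≤B k n))

  B⟶0 : ∀ k → B k ⟶0
  B⟶0 zero    = y⟶0 zero
  B⟶0 (suc k) = ⟶0-+ (y⟶0 (suc k)) (⟶0-* (C k) (B⟶0 k))

  gap : ℕ → ℚ
  gap n = r n - r (suc n)

  0≤gap : ∀ n → 0ℚ ≤ gap n
  0≤gap n = ≤-trans (0≤* (0≤r n) (0≤r (suc n))) (≤-reflexive (r-diff n))

  B-drop : ∀ k n → P k n * gap n ≤ B k n - B k (suc n)
  B-drop zero    n = ≤-reflexive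
    (solve 2 (λ a b → con 1ℚ :* (a :- b) := con 1ℚ :* a :- con 1ℚ :* b) refl (r n) (r (suc n)))
  B-drop (suc k) n = begin
    p * (ρ - ρ′)
      ≡⟨ solve 5 (λ p ρ ρ′ c q → p :* (ρ :- ρ′) :=
           (p :* ρ :- (p :+ c :* (q :* ρ′)) :* ρ′) :+ c :* (q :* (ρ′ :* ρ′))) refl p ρ ρ′ c q ⟩
    (p * ρ - (p + c * (q * ρ′)) * ρ′) + c * (q * (ρ′ * ρ′))
      ≤⟨ +-mono-≤
           (ℚₚ.+-monoʳ-≤ (p * ρ) (ℚₚ.neg-antimono-≤
             (ℚₚ.*-monoʳ-≤-nonNeg ρ′ {{0≤⇒nonNeg (0≤r (suc n))}} (P-step k n))))
           (ℚₚ.*-monoˡ-≤-nonNeg c {{0≤⇒nonNeg (0≤C k)}}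
             (ℚₚ.*-monoˡ-≤-nonNeg q {{0≤⇒nonNeg (0≤P k n)}}
               (≤-trans (ℚₚ.*-monoʳ-≤-nonNeg ρ′ {{0≤⇒nonNeg (0≤r (suc n))}} (r-anti n))
                        (≤-reflexive (r-diff n))))) ⟩
    (p * ρ - P (suc k) (suc n) * ρ′) + c * (q * gap n)
      ≤⟨ ℚₚ.+-monoʳ-≤ (p * ρ - P (suc k) (suc n) * ρ′)
           (ℚₚ.*-monoˡ-≤-nonNeg c {{0≤⇒nonNeg (0≤C k)}} (B-drop k n)) ⟩
    (p * ρ - P (suc k) (suc n) * ρ′) + c * (B k n - B k (suc n))
      ≡⟨ solve 5 (λ s t c b b′ → (s :- t) :+ c :* (b :- b′) := (s :+ c :* b) :- (t :+ c :* b′)) refl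
           (p * ρ) (P (suc k) (suc n) * ρ′) c (B k n) (B k (suc n)) ⟩
    (p * ρ + c * B k n) - (P (suc k) (suc n) * ρ′ + c * B k (suc n)) ∎
    where
    p  = P (suc k) n
    q  = P k n
    c  = C k
    ρ  = r n
    ρ′ = r (suc n)

  summable : ∀ (x : ℕ → ℚ) k → (∀ n → ∣ x (suc n) - x n ∣ ≤ 2ℚ * (P k n * gap n)) → Cauchy x
  summable x k bound = cauchy-telescope {x} (λ n → 2ℚ * B k n)
    (λ n → 0≤* 0≤2 (0≤B k n)) (⟶0-* 2ℚ (B⟶0 k))
    (λ n → ≤-trans (bound n) (≤-trans (ℚₚ.*-monoˡ-≤-nonNeg 2ℚ (B-drop k n))
      (≤-reflexive (solve 3 (λ c a b → c :* (a :- b) := c :* a :- c :* b) refl 2ℚ (B k n) (B k (suc n))))))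

  ^-≤ : ∀ n s .{{_ : NonZero s}} → + 1 /suc n ^ s ≤ r n
  ^-≤ n (suc s) = 1/-anti (suc n ℕ.^ suc s) (suc n) {{ℕₚ.m^n≢0 (suc n) (suc s)}}
    (ℕₚ.m≤m*n (suc n) (suc n ℕ.^ s) {{ℕₚ.m^n≢0 (suc n) s}})

  ^-≤-gap : ∀ n s → 2 ℕ.≤ s → + 1 /suc n ^ s ≤ 2ℚ * gap n
  ^-≤-gap n (suc (suc s)) _ = begin
    + 1 /suc n ^ suc (suc s)      ≤⟨ 1/-anti (suc n ℕ.^ suc (suc s)) (suc n ℕ.* suc n) {{ℕₚ.m^n≢0 (suc n) (suc (suc s))}}
                                       (ℕₚ.*-monoʳ-≤ (suc n) (ℕₚ.m≤m*n (suc n) (suc n ℕ.^ s) {{ℕₚ.m^n≢0 (suc n) s}})) ⟩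
    + 1 / (suc n ℕ.* suc n)       ≡⟨ r-square n ⟩
    r n * r n                     ≡⟨ solve 2 (λ a b → a :* a := a :* (b :+ (a :- b))) refl (r n) (r (suc n)) ⟩
    r n * (r (suc n) + gap n)     ≤⟨ ℚₚ.*-monoˡ-≤-nonNeg (r n) {{0≤⇒nonNeg (0≤r n)}} (ℚₚ.+-monoʳ-≤ (r (suc n)) gap≤) ⟩
    r n * (r (suc n) + r (suc n)) ≡⟨ solve 2 (λ a b → a :* (b :+ b) := con 2ℚ :* (a :* b)) refl (r n) (r (suc n)) ⟩
    2ℚ * (r n * r (suc n))        ≡⟨ cong (2ℚ *_) (r-diff n) ⟩
    2ℚ * gap n                    ∎
    where
    gap≤ : gap n ≤ r (suc n)
    gap≤ = begin
      gap n             ≡⟨ sym (r-diff n) ⟩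
      r n * r (suc n)   ≤⟨ ℚₚ.*-monoʳ-≤-nonNeg (r (suc n)) {{0≤⇒nonNeg (0≤r (suc n))}} (r≤1 n) ⟩
      1ℚ * r (suc n)    ≡⟨ ℚₚ.*-identityˡ (r (suc n)) ⟩
      r (suc n)         ∎
  ^-≤-gap n (suc zero) (s≤s ())

  Unit : ℤ → Set
  Unit z = z ≡ + 1 ⊎ z ≡ -1ℤ

  unit-* : ∀ {a b} → Unit a → Unit b → Unit (a ℤ.* b)
  unit-* (inj₁ refl) (inj₁ refl) = inj₁ refl
  unit-* (inj₁ refl) (inj₂ refl) = inj₂ refl
  unit-* (inj₂ refl) (inj₁ refl) = inj₂ refl
  unit-* (inj₂ refl) (inj₂ refl) = inj₁ refl

  unit-^ : ∀ {a} → Unit a → ∀ n → Unit (a ℤ.^ n)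
  unit-^ ua zero    = inj₁ refl
  unit-^ ua (suc n) = unit-* ua (unit-^ ua n)

  unit-^ˢ : ∀ σ n → Unit (σ ^ˢ n)
  unit-^ˢ Sign.+ = unit-^ (inj₁ refl)
  unit-^ˢ Sign.- = unit-^ (inj₂ refl)

  ∣unit∣ : ∀ {z} → Unit z → ∀ n s → ∣ z /suc n ^ s ∣ ≡ + 1 /suc n ^ s
  ∣unit∣ (inj₁ refl) n s = ℚₚ.0≤p⇒∣p∣≡p (0≤^ n s)
    where
    0≤^ : ∀ n s → 0ℚ ≤ + 1 /suc n ^ s
    0≤^ n s = ℚₚ.nonNegative⁻¹ _ {{ℚₚ.normalize-nonNeg 1 (suc n ℕ.^ s) {{ℕₚ.m^n≢0 (suc n) s}}}}
  ∣unit∣ (inj₂ refl) n s = trans (ℚₚ.∣-p∣≡∣p∣ (+ 1 /suc n ^ s)) (∣unit∣ (inj₁ refl) n s)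

  ∣entry∣ : ∀ a n → ∣ (sign a ^ˢ suc n) /suc n ^ exponent a ∣ ≤ r n
  ∣entry∣ ⟨ s , σ ⟩ n = ≤-trans (≤-reflexive (∣unit∣ (unit-^ˢ σ (suc n)) n s)) (^-≤ n s)

  ∣ζ≤∣ : ∀ w n → ∣ ζ≤ w n ∣ ≤ Q (List.length w) n
  ∣ζ≤∣ []      n       = ≤-refl
  ∣ζ≤∣ (a ∷ w) zero    = 0≤Q (suc (List.length w)) zero
  ∣ζ≤∣ (a ∷ w) (suc n) = begin
    ∣ ζ≤ (a ∷ w) n + t * ζ≤ w n ∣       ≤⟨ ℚₚ.∣p+q∣≤∣p∣+∣q∣ (ζ≤ (a ∷ w) n) (t * ζ≤ w n) ⟩
    ∣ ζ≤ (a ∷ w) n ∣ + ∣ t * ζ≤ w n ∣   ≡⟨ cong (λ s → ∣ ζ≤ (a ∷ w) n ∣ + s) (ℚₚ.∣p*q∣≡∣p∣*∣q∣ t (ζ≤ w n)) ⟩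
    ∣ ζ≤ (a ∷ w) n ∣ + ∣ t ∣ * ∣ ζ≤ w n ∣
      ≤⟨ +-mono-≤ (∣ζ≤∣ (a ∷ w) n) (*-mono (0≤r n) (ℚₚ.0≤∣p∣ (ζ≤ w n)) (∣entry∣ a n) (∣ζ≤∣ w n)) ⟩
    h n * q + r n * q                   ≡⟨ sym (ℚₚ.*-distribʳ-+ q (h n) (r n)) ⟩
    h (suc n) * q                       ≤⟨ ℚₚ.*-monoˡ-≤-nonNeg (h (suc n)) {{0≤⇒nonNeg (0≤h (suc n))}} (Q-mono k n) ⟩
    h (suc n) * Q k (suc n)             ∎
    where
    t = (sign a ^ˢ suc n) /suc n ^ exponent a
    k = List.length w
    q = Q k n

  ∣ζ≤∣′ : ∀ w n → ∣ ζ≤ w n ∣ ≤ P (List.length w) n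
  ∣ζ≤∣′ w n = ≤-trans (∣ζ≤∣ w n) (Q-mono (List.length w) n)

  cancel : ∀ p q → (p + q) - p ≡ q
  cancel = solve 2 (λ p q → (p :+ q) :- p := q) refl

  ζ-cauchy-≥2 : ∀ a w → 2 ℕ.≤ exponent a → Cauchy (ζ≤ (a ∷ w))
  ζ-cauchy-≥2 a w 2≤s = summable (ζ≤ (a ∷ w)) k λ n → begin
    ∣ ζ≤ (a ∷ w) (suc n) - ζ≤ (a ∷ w) n ∣
      ≡⟨ cong ∣_∣ (cancel (ζ≤ (a ∷ w) n) (t n * ζ≤ w n)) ⟩
    ∣ t n * ζ≤ w n ∣
      ≡⟨ ℚₚ.∣p*q∣≡∣p∣*∣q∣ (t n) (ζ≤ w n) ⟩
    ∣ t n ∣ * ∣ ζ≤ w n ∣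
      ≤⟨ *-mono (0≤* 0≤2 (0≤gap n)) (ℚₚ.0≤∣p∣ (ζ≤ w n))
           (≤-trans (≤-reflexive (∣unit∣ (unit-^ˢ (sign a) (suc n)) n (exponent a)))
                    (^-≤-gap n (exponent a) 2≤s))
           (∣ζ≤∣′ w n) ⟩
    2ℚ * gap n * P k n
      ≡⟨ solve 3 (λ c g p → c :* g :* p := c :* (p :* g)) refl 2ℚ (gap n) (P k n) ⟩
    2ℚ * (P k n * gap n) ∎
    where
    k = List.length w
    t = λ n → (sign a ^ˢ suc n) /suc n ^ exponent a

  -- With x = ζ≤ (1̄ ∷ w), e = (-1)ⁿ⁺¹ and a = rₙ ζ≤ w n, the increments of
  -- x + ½ e a are ½ e (aₙ - aₙ₊₁), which are absolutely summable.
  module Alternating (w : List Entry) where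

    k = List.length w

    x z a e v : ℕ → ℚ
    x = ζ≤ (⟨ 1 , Sign.- ⟩ ∷ w)
    z = ζ≤ w
    a n = r n * z n
    e n = (Sign.- ^ˢ suc n) / 1
    v n = x n + ½ * (e n * a n)

    e-suc : ∀ n → e (suc n) ≡ - e n
    e-suc n with Sign.- ^ˢ suc n | unit-^ˢ Sign.- (suc n)
    ... | _ | inj₁ refl = refl
    ... | _ | inj₂ refl = refl

    ∣e∣ : ∀ n → ∣ e n ∣ ≡ 1ℚ
    ∣e∣ n with Sign.- ^ˢ suc n | unit-^ˢ Sign.- (suc n)
    ... | _ | inj₁ refl = refl
    ... | _ | inj₂ refl = refl

    1/-cong : ∀ {d d′} .{{_ : NonZero d}} .{{_ : NonZero d′}} → d ≡ d′ → + 1 / d ≡ + 1 / d′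
    1/-cong refl = refl

    ^1 : ∀ n → + 1 /suc n ^ 1 ≡ r n
    ^1 n = 1/-cong {{ℕₚ.m^n≢0 (suc n) 1}} (ℕₚ.*-identityʳ (suc n))

    term : ∀ n → (Sign.- ^ˢ suc n) /suc n ^ 1 ≡ e n * r n
    term n with Sign.- ^ˢ suc n | unit-^ˢ Sign.- (suc n)
    ... | _ | inj₁ refl = trans (^1 n) (sym (ℚₚ.*-identityˡ (r n)))
    ... | _ | inj₂ refl = trans (cong -_ (^1 n)) (solve 1 (λ p → :- p := con (- 1ℚ) :* p) refl (r n))

    x-suc : ∀ n → x (suc n) ≡ x n + e n * a n
    x-suc n = cong (λ s → x n + s) (trans (cong (_* z n) (term n)) (ℚₚ.*-assoc (e n) (r n) (z n)))

    ∣Δz∣ : ∀ w n → ∣ ζ≤ w (suc n) - ζ≤ w n ∣ ≤ r n * P (List.length w) n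
    ∣Δz∣ []      n = 0≤* (0≤r n) (0≤P 0 n)
    ∣Δz∣ (b ∷ w) n = begin
      ∣ ζ≤ (b ∷ w) (suc n) - ζ≤ (b ∷ w) n ∣
        ≡⟨ cong ∣_∣ (cancel (ζ≤ (b ∷ w) n) (t * ζ≤ w n)) ⟩
      ∣ t * ζ≤ w n ∣
        ≡⟨ ℚₚ.∣p*q∣≡∣p∣*∣q∣ t (ζ≤ w n) ⟩
      ∣ t ∣ * ∣ ζ≤ w n ∣
        ≤⟨ *-mono (0≤r n) (ℚₚ.0≤∣p∣ (ζ≤ w n)) (∣entry∣ b n)
             (≤-trans (∣ζ≤∣′ w n) (P-suc (List.length w) n)) ⟩
      r n * P (suc (List.length w)) n ∎
      where t = (sign b ^ˢ suc n) /suc n ^ exponent b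

    ∣Δa∣ : ∀ n → ∣ a n - a (suc n) ∣ ≤ 2ℚ * (P k n * gap n)
    ∣Δa∣ n = begin
      ∣ a n - a (suc n) ∣
        ≡⟨ cong ∣_∣ (solve 4 (λ ρ ρ′ z z′ → ρ :* z :- ρ′ :* z′ := (ρ :- ρ′) :* z :- ρ′ :* (z′ :- z)) refl
             (r n) (r (suc n)) (z n) (z (suc n))) ⟩
      ∣ gap n * z n - r (suc n) * (z (suc n) - z n) ∣
        ≤⟨ ℚₚ.∣p-q∣≤∣p∣+∣q∣ (gap n * z n) (r (suc n) * (z (suc n) - z n)) ⟩
      ∣ gap n * z n ∣ + ∣ r (suc n) * (z (suc n) - z n) ∣
        ≡⟨ cong₂ _+_ (ℚₚ.∣p*q∣≡∣p∣*∣q∣ (gap n) (z n))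
                     (ℚₚ.∣p*q∣≡∣p∣*∣q∣ (r (suc n)) (z (suc n) - z n)) ⟩
      ∣ gap n ∣ * ∣ z n ∣ + ∣ r (suc n) ∣ * ∣ z (suc n) - z n ∣
        ≤⟨ +-mono-≤
             (*-mono (0≤gap n) (ℚₚ.0≤∣p∣ (z n)) (≤-reflexive (ℚₚ.0≤p⇒∣p∣≡p (0≤gap n))) (∣ζ≤∣′ w n))
             (*-mono (0≤r (suc n)) (ℚₚ.0≤∣p∣ (z (suc n) - z n))
               (≤-reflexive (ℚₚ.0≤p⇒∣p∣≡p (0≤r (suc n)))) (∣Δz∣ w n)) ⟩
      gap n * P k n + r (suc n) * (r n * P k n)
        ≡⟨ solve 3 (λ ρ ρ′ p → (ρ :- ρ′) :* p :+ ρ′ :* (ρ :* p) := (ρ :- ρ′) :* p :+ (ρ :* ρ′) :* p) refl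
             (r n) (r (suc n)) (P k n) ⟩
      gap n * P k n + r n * r (suc n) * P k n
        ≡⟨ cong (λ t → gap n * P k n + t * P k n) (r-diff n) ⟩
      gap n * P k n + gap n * P k n
        ≡⟨ solve 2 (λ g p → g :* p :+ g :* p := con 2ℚ :* (p :* g)) refl (gap n) (P k n) ⟩
      2ℚ * (P k n * gap n) ∎

    ∣½e*∣ : ∀ n p → ∣ ½ * (e n * p) ∣ ≤ ∣ p ∣
    ∣½e*∣ n p = begin
      ∣ ½ * (e n * p) ∣       ≡⟨ ℚₚ.∣p*q∣≡∣p∣*∣q∣ ½ (e n * p) ⟩
      ½ * ∣ e n * p ∣         ≡⟨ cong (½ *_) (trans (ℚₚ.∣p*q∣≡∣p∣*∣q∣ (e n) p) (cong (_* ∣ p ∣) (∣e∣ n))) ⟩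
      ½ * (1ℚ * ∣ p ∣)        ≡⟨ cong (½ *_) (ℚₚ.*-identityˡ ∣ p ∣) ⟩
      ½ * ∣ p ∣               ≤⟨ ℚₚ.*-monoʳ-≤-nonNeg ∣ p ∣ {{ℚₚ.∣-∣-nonNeg p}} ½≤1 ⟩
      1ℚ * ∣ p ∣              ≡⟨ ℚₚ.*-identityˡ ∣ p ∣ ⟩
      ∣ p ∣                   ∎
      where
      ½≤1 : ½ ≤ 1ℚ
      ½≤1 = 1/-anti 2 1 (s≤s z≤n)

    v-cauchy : Cauchy v
    v-cauchy = summable v k λ n → begin
      ∣ (x (suc n) + ½ * (e (suc n) * a (suc n))) - (x n + ½ * (e n * a n)) ∣
        ≡⟨ cong ∣_∣ (cong₂ (λ p q → (p + ½ * (q * a (suc n))) - (x n + ½ * (e n * a n))) (x-suc n) (e-suc n)) ⟩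
      ∣ (x n + e n * a n + ½ * (- e n * a (suc n))) - (x n + ½ * (e n * a n)) ∣
        ≡⟨ cong ∣_∣ (solve 4 (λ x e a a′ →
             (x :+ e :* a :+ con ½ :* (:- e :* a′)) :- (x :+ con ½ :* (e :* a)) :=
             con ½ :* (e :* (a :- a′))) refl (x n) (e n) (a n) (a (suc n))) ⟩
      ∣ ½ * (e n * (a n - a (suc n))) ∣
        ≤⟨ ∣½e*∣ n (a n - a (suc n)) ⟩
      ∣ a n - a (suc n) ∣
        ≤⟨ ∣Δa∣ n ⟩
      2ℚ * (P k n * gap n) ∎

    ½ea⟶0 : (λ n → ½ * (e n * a n)) ⟶0
    ½ea⟶0 = ⟶0-≤ (λ n → begin
      ∣ ½ * (e n * a n) ∣   ≤⟨ ∣½e*∣ n (a n) ⟩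
      ∣ r n * z n ∣         ≡⟨ ℚₚ.∣p*q∣≡∣p∣*∣q∣ (r n) (z n) ⟩
      ∣ r n ∣ * ∣ z n ∣     ≤⟨ *-mono (0≤r n) (ℚₚ.0≤∣p∣ (z n)) (≤-reflexive (ℚₚ.0≤p⇒∣p∣≡p (0≤r n))) (∣ζ≤∣′ w n) ⟩
      r n * P k n           ≡⟨ ℚₚ.*-comm (r n) (P k n) ⟩
      y k n                 ≤⟨ p≤∣p∣ (y k n) ⟩
      ∣ y k n ∣             ∎) (y⟶0 k)

    x-cauchy : Cauchy x
    x-cauchy = cauchy-cong {λ n → v n + - 1ℚ * b n}
      (λ n → solve 2 (λ x t → (x :+ t) :+ con (- 1ℚ) :* t := x) refl (x n) (b n))
      (cauchy-+ {v} v-cauchy (cauchy-* (- 1ℚ) {b} (cauchy-⟶0 ½ea⟶0)))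
      where b = λ n → ½ * (e n * a n)

  ζ-cauchy : ∀ a w → ¬ (exponent a ≡ 1 × sign a ≡ Sign.+) → Cauchy (ζ≤ (a ∷ w))
  ζ-cauchy ⟨ suc (suc s) , σ ⟩ w _   = ζ-cauchy-≥2 ⟨ suc (suc s) , σ ⟩ w (s≤s (s≤s z≤n))
  ζ-cauchy ⟨ 1 , Sign.- ⟩      w _   = Alternating.x-cauchy w
  ζ-cauchy ⟨ 1 , Sign.+ ⟩      w adm = ⊥-elim (adm (refl , refl))

  ∣∑<∣ : ∀ {f g} → (∀ k → ∣ f k ∣ ≤ g k) → ∀ n → ∣ ∑< n f ∣ ≤ ∑< n g
  ∣∑<∣ f≤g zero    = ≤-refl
  ∣∑<∣ {f} f≤g (suc n) = ≤-trans (ℚₚ.∣p+q∣≤∣p∣+∣q∣ (∑< n f) (f n)) (+-mono-≤ (∣∑<∣ f≤g n) (f≤g n))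

  ∣H∣ : ∀ s .{{_ : NonZero s}} n → ∣ H s n ∣ ≤ h n
  ∣H∣ s = ∣∑<∣ λ k → ≤-trans (≤-reflexive (∣unit∣ (inj₁ refl) k s)) (^-≤ k s)

  ∣H̄∣ : ∀ s .{{_ : NonZero s}} n → ∣ H̄ s n ∣ ≤ h n
  ∣H̄∣ s = ∣∑<∣ λ k → ≤-trans (≤-reflexive (∣unit∣ (unit-^ (inj₂ refl) k) k s)) (^-≤ k s)

  ∣∏∣ : ∀ {m} (f : Vector ℚ m) n → (∀ j → ∣ f j ∣ ≤ h n) → ∣ ∏ f ∣ ≤ Q m n
  ∣∏∣ {zero}  f n f≤h = ≤-refl
  ∣∏∣ {suc m} f n f≤h = begin
    ∣ f zero * ∏ (f ∘ suc) ∣        ≡⟨ ℚₚ.∣p*q∣≡∣p∣*∣q∣ (f zero) (∏ (f ∘ suc)) ⟩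
    ∣ f zero ∣ * ∣ ∏ (f ∘ suc) ∣    ≤⟨ *-mono (0≤h n) (ℚₚ.0≤∣p∣ (∏ (f ∘ suc))) (f≤h zero) (∣∏∣ (f ∘ suc) n (f≤h ∘ suc)) ⟩
    h n * Q m n                     ∎

  euler-cauchy : ∀ {m} (f : ℕ → Vector ℚ m) q → 2 ℕ.≤ q → (∀ n j → ∣ f n j ∣ ≤ h n) →
                 Cauchy (λ N → ∑[ n < N ] ∏ (f (suc n)) * + 1 /suc n ^ q)
  euler-cauchy {m} f q 2≤q f≤h = summable (λ N → ∑< N term) m λ n → begin
    ∣ (∑< n term + term n) - ∑< n term ∣
      ≡⟨ cong ∣_∣ (cancel (∑< n term) (term n)) ⟩
    ∣ ∏ (f (suc n)) * t n ∣
      ≡⟨ ℚₚ.∣p*q∣≡∣p∣*∣q∣ (∏ (f (suc n))) (t n) ⟩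
    ∣ ∏ (f (suc n)) ∣ * ∣ t n ∣
      ≤⟨ *-mono (0≤P m n) (ℚₚ.0≤∣p∣ (t n)) (∣∏∣ (f (suc n)) (suc n) (f≤h (suc n)))
           (≤-trans (≤-reflexive (∣unit∣ (inj₁ refl) n q)) (^-≤-gap n q 2≤q)) ⟩
    P m n * (2ℚ * gap n)
      ≡⟨ solve 3 (λ p c g → p :* (c :* g) := c :* (p :* g)) refl (P m n) 2ℚ (gap n) ⟩
    2ℚ * (P m n * gap n) ∎
    where
    t    = λ n → + 1 /suc n ^ q
    term = λ n → ∏ (f (suc n)) * t n

record Index : Set where
  constructor index
  field
    head       : Entry
    tail       : List Entry
    admissible : ¬ (exponent head ≡ 1 × sign head ≡ Sign.+)

ζ : Index → ℝ
ζ (index a w admissible) = lim (ζ≤ (a ∷ w)) (Convergence.ζ-cauchy a w admissible)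

infixr 5 1+_∷_

-- 1+ t ∷ θ is the composition whose first part is suc t.
data Composition : ℕ → Set where
  []    : Composition 0
  1+_∷_ : ∀ t {n} → Composition n → Composition (suc t ℕ.+ n)

grow : ∀ {n} → Composition n → List (Composition (suc n))
grow []         = []
grow (1+ t ∷ θ) = (1+ suc t ∷ θ) ∷ []

-- 𝒞ₘ: the first part either equals 1 or is at least 2.
compositions : ∀ m → List (Composition m)
compositions zero    = [] ∷ []
compositions (suc m) = List.map (1+ 0 ∷_) (compositions m) ++ concatMap grow (compositions m)

∈-compositions : ∀ {m} (θ : Composition m) → θ ∈ compositions m
∈-compositions [] = here refl
∈-compositions (1+ t ∷ θ) = first t θ
  where
  first : ∀ t {n} (θ : Composition n) → (1+ t ∷ θ) ∈ compositions (suc t ℕ.+ n)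
  first zero    θ = ∈-++⁺ˡ (∈-map⁺ (1+ 0 ∷_) (∈-compositions θ))
  first (suc t) {n} θ = ∈-++⁺ʳ (List.map (1+ 0 ∷_) (compositions (suc t ℕ.+ n)))
    (∈-concatMap⁺ grow (Any.map (λ { refl → here refl }) (first t θ)))

compositions-unique : ∀ m → Unique (compositions m)
compositions-unique zero    = [] ∷ []
compositions-unique (suc m) = Uniqueₚ.++⁺
  (Uniqueₚ.map⁺ (λ { refl → refl }) (compositions-unique m))
  (grow-unique (compositions-unique m)) disjoint
  where
  shrink : ∀ {n} → Composition (suc n) → Composition n
  shrink (1+ zero ∷ θ)  = θ
  shrink (1+ suc t ∷ θ) = 1+ t ∷ θ

  shrink-grow : ∀ {n} (θ : Composition n) {η} → η ∈ grow θ → shrink η ≡ θ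
  shrink-grow (1+ t ∷ θ) (here refl) = refl

  fresh : ∀ {n} {η : Composition (suc n)} {xs} → All (shrink η ≢_) xs → All (η ≢_) (concatMap grow xs)
  fresh []                      = []
  fresh {xs = θ ∷ _} (η≢ ∷ rest) =
    Allₚ.++⁺ (All.tabulate (λ { p refl → η≢ (shrink-grow θ p) })) (fresh rest)

  grow-unique : ∀ {n} {xs : List (Composition n)} → Unique xs → Unique (concatMap grow xs)
  grow-unique []                               = []
  grow-unique {xs = [] ∷ _}         (_ ∷ u)    = grow-unique u
  grow-unique {xs = (1+ t ∷ θ) ∷ _} (θ∉ ∷ u)   = fresh θ∉ ∷ grow-unique u

  grown : ∀ {n} {θ : Composition n} xs → ¬ ((1+ 0 ∷ θ) ∈ concatMap grow xs)
  grown ([] ∷ xs)            p          = grown xs p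
  grown ((1+ t ∷ θ) ∷ xs)    (there p)  = grown xs p

  disjoint : ∀ {θ} → ¬ (θ ∈ List.map (1+ 0 ∷_) (compositions m) × θ ∈ concatMap grow (compositions m))
  disjoint (p , q) with ∈-map⁻ (1+ 0 ∷_) p
  ... | _ , _ , refl = grown (compositions m) q

∏! : ∀ {m} → Composition m → ℕ
∏! []         = 1
∏! (1+ t ∷ θ) = suc t ! ℕ.* ∏! θ

∏!-nonZero : ∀ {m} (θ : Composition m) → NonZero (∏! θ)
∏!-nonZero []         = _
∏!-nonZero (1+ t ∷ θ) = ℕₚ.m*n≢0 (suc t !) (∏! θ) {{suc t ℕₚ.!≢0}} {{∏!-nonZero θ}}

Block : Set → Set
Block A = ∃ λ t → Vec A (suc t)

blocks : ∀ {A m} → Composition m → Vec A m → List (Block A)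
blocks []         xs = []
blocks (1+ t ∷ θ) xs = (t , Vec.take (suc t) xs) ∷ blocks θ (Vec.drop (suc t) xs)

-- 𝒮ₘ, indexed by the image of the first point and the permutation induced on
-- the remaining points.
permutations : ∀ m → List (Permutation′ m)
permutations zero    = Perm.id ∷ []
permutations (suc m) = concatMap (λ j → List.map (insert zero j) (permutations m)) (allFin (suc m))

∈-permutations : ∀ {m} (π : Permutation′ m) → Any (Perm._≈ π) (permutations m)
∈-permutations {zero}  π = here λ ()
∈-permutations {suc m} π = Anyₚ.concatMap⁺ _ (Any.map (λ { refl →
    Anyₚ.map⁺ (Any.map (λ {ρ} ρ≈ → ins ρ ρ≈) (∈-permutations (remove zero π))) })
    (∈-allFin (π ⟨$⟩ʳ zero)))
  where
  ins : ∀ ρ → ρ Perm.≈ remove zero π → insert zero (π ⟨$⟩ʳ zero) ρ Perm.≈ π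
  ins ρ ρ≈ zero    = refl
  ins ρ ρ≈ (suc k) = trans (Perm.insert-punchIn zero (π ⟨$⟩ʳ zero) ρ k)
    (trans (cong (punchIn (π ⟨$⟩ʳ zero)) (ρ≈ k)) (sym (Perm.punchIn-permute π zero k)))

permutations-unique : ∀ m → AllPairs (λ π ρ → ¬ π Perm.≈ ρ) (permutations m)
permutations-unique zero    = [] ∷ []
permutations-unique (suc m) = all (Uniqueₚ.allFin⁺ (suc m))
  where
  ps = permutations m

  tail : ∀ j {π ρ} → insert zero j π Perm.≈ insert zero j ρ → π Perm.≈ ρ
  tail j {π} {ρ} π≈ρ k = punchIn-injective j _ _
    (trans (sym (Perm.insert-punchIn zero j π k))
      (trans (π≈ρ (suc k)) (Perm.insert-punchIn zero j ρ k)))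

  apart : ∀ {j} {π : Permutation′ m} {js} → All (j ≢_) js →
          All (λ ρ → ¬ insert zero j π Perm.≈ ρ) (concatMap (λ j → List.map (insert zero j) ps) js)
  apart []          = []
  apart (j≢ ∷ rest) = Allₚ.++⁺ (Allₚ.map⁺ (All.universal (λ _ π≈ρ → j≢ (π≈ρ zero)) ps)) (apart rest)

  all : ∀ {js} → Unique js →
        AllPairs (λ π ρ → ¬ π Perm.≈ ρ) (concatMap (λ j → List.map (insert zero j) ps) js)
  all []                = []
  all {j ∷ _} (j∉ ∷ u) = AllPairsₚ.++⁺
    (AllPairsₚ.map⁺ (AllPairs.map (λ {π} {ρ} π≉ρ π≈ρ → π≉ρ (tail j {π} {ρ} π≈ρ)) (permutations-unique m)))
    (all u)
    (Allₚ.map⁺ (All.universal (λ _ → apart j∉) ps))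

χℕ : ℤ → ℕ
χℕ (+ suc _) = 1
χℕ _         = 0

-- The indices i₁, …, iₘ are a function on Fin m, so that j : Fin m stands for
-- the position suc (toℕ j); the positions above l carry an overline.
module EulerSum {m : ℕ} (l : ℕ) (i : Fin m → ℕ) (i≥1 : ∀ j → 1 ℕ.≤ i j)
                (q : ℕ) (q≥2 : 2 ℕ.≤ q) where

  factor : ℕ → Vector ℚ m
  factor n j = if toℕ j <ᵇ l then H (i j) n else H̄ (i j) n

  ∣factor∣ : ∀ n j → ∣ factor n j ∣ ≤ Convergence.h n
  ∣factor∣ n j with toℕ j <ᵇ l
  ... | true  = Convergence.∣H∣ (i j) {{ℕ.>-nonZero (i≥1 j)}} n
  ... | false = Convergence.∣H̄∣ (i j) {{ℕ.>-nonZero (i≥1 j)}} n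

  S : ℝ
  S = lim (λ N → ∑[ n < N ] ∏ (factor (suc n)) * + 1 /suc n ^ q)
          (Convergence.euler-cauchy factor q q≥2 ∣factor∣)

  -- The c-th block is ρ(θ₁+⋯+θ_{c-1}+1), …, ρ(θ₁+⋯+θ_c); on it, λᵇ is λ_c and
  -- iᵇ is the sum of the corresponding exponents.
  ρ-blocks : Composition m → Permutation′ m → List (Block (Fin m))
  ρ-blocks θ ρ = blocks θ (tabulate (ρ ⟨$⟩ʳ_))

  λᵇ : Block (Fin m) → ℕ
  λᵇ (_ , b) = Vec.sum (Vec.map (λ j → χℕ (+ suc (toℕ j) ℤ.- + l)) b)

  iᵇ : Block (Fin m) → ℕ
  iᵇ (_ , b) = Vec.sum (Vec.map i b)

  iᵇ≥1 : ∀ b → 1 ℕ.≤ iᵇ b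
  iᵇ≥1 (_ , j ∷ b) = ℕₚ.≤-trans (i≥1 j) (ℕₚ.m≤m+n (i j) _)

  bar : ℕ → Sign
  bar n = toSign (parity n)

  T̃ : Block (Fin m) → Entry
  T̃ b = ⟨ iᵇ b , bar (λᵇ b) ⟩ {{ℕ.>-nonZero (iᵇ≥1 b)}}

  T̂ : Block (Fin m) → Entry
  T̂ b = ⟨ q ℕ.+ iᵇ b , bar (λᵇ b) ⟩ {{ℕ.>-nonZero (ℕₚ.≤-trans (iᵇ≥1 b) (ℕₚ.m≤n+m (iᵇ b) q))}}

  q⁺ : Entry
  q⁺ = ⟨ q , Sign.+ ⟩ {{ℕ.>-nonZero (ℕₚ.<⇒≤ q≥2)}}

  ≥2-admissible : ∀ {s} {A : Set} → 2 ℕ.≤ s → ¬ (s ≡ 1 × A)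
  ≥2-admissible (s≤s ()) (refl , _)

  q,T̃ : Composition m → Permutation′ m → Index
  q,T̃ θ ρ = index q⁺ (List.map T̃ (ρ-blocks θ ρ)) (≥2-admissible q≥2)

  -- The first clause of merge is reached only for m = 0.
  T̂,T̃ : Composition m → Permutation′ m → Index
  T̂,T̃ θ ρ = merge (ρ-blocks θ ρ)
    where
    merge : List (Block (Fin m)) → Index
    merge []       = index q⁺ [] (≥2-admissible q≥2)
    merge (b ∷ bs) = index (T̂ b) (List.map T̃ bs) (≥2-admissible (ℕₚ.≤-trans q≥2 (ℕₚ.m≤m+n q (iᵇ b))))

  coeff : Composition m → Permutation′ m → ℚ
  coeff θ ρ = (-1ℤ ℤ.^ ℕ.sum (List.map λᵇ (ρ-blocks θ ρ)) / ∏! θ) {{∏!-nonZero θ}}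

{-# OPTIONS --safe #-}
-- Both sides agree at every truncation N, because the following finite
-- identity holds for arbitrary a₁, …, aₘ : ℕ → ℚ:
--   ∏ⱼ Σ_{k<n} aⱼ(k) = Σ_θ Σ_ρ (∏ 1/θ_c!) Σ_{n>k₁>⋯>k_p} ∏_c ∏_{j in block c of θ, ρ} aⱼ(k_c).
-- It is proved by induction on n.  On the right, passing to n + 1 adds the terms
-- whose first block sits at k₁ = n; averaged over the orders inside that block
-- they run through the choices of a nonempty subset of the factors, which is how
-- ∏ⱼ (gⱼ + aⱼ(n)) expands, with gⱼ = Σ_{k<n} aⱼ(k).  For 1/n^q times the product
-- with strict upper bound n + 1, the first block is either below n, which gives
-- ζ(q, T̃₁, …), or merges with q, which gives ζ(T̂₁, T̃₂, …).

module Submission where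

open import Defs
open import Data.Nat.Base using (ℕ; _≤_; _<_)
open import Data.Fin.Base as Fin using (Fin; toℕ)

open import Data.Bool.Base using (T; true; false)
open import Data.Fin.Base using (zero; suc; punchIn)
open import Data.Fin.Permutation as Perm using (Permutation′; _⟨$⟩ʳ_; insert)
open import Data.Integer.Base as ℤ using (ℤ; -1ℤ)
import Data.Integer.Properties as ℤₚ
open import Algebra.Properties.CommutativeSemigroup ℤₚ.*-commutativeSemigroup using (interchange)
open import Data.List.Base as List using (List; []; _∷_; _++_; foldr; concatMap; allFin)
import Data.List.Properties as Listₚ
open import Data.Nat.Base as ℕ using (zero; suc; NonZero; parity; _<ᵇ_; _!)
import Data.Nat.ListAction as ℕ
import Data.Nat.Properties as ℕₚ
open import Data.Parity.Base using (toSign)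
import Data.Parity.Properties as Parityₚ
open import Data.Product.Base using (_,_; proj₂)
open import Data.Rational.Base using (ℚ; 0ℚ; 1ℚ; _/_; _+_; _*_; _-_; ∣_∣; *-1-rawMonoid)
import Data.Rational.Base as ℚ
import Data.Rational.Properties as ℚₚ
open import Data.Rational.Solver using (module +-*-Solver)
import Data.Rational.Unnormalised.Base as ℚᵘ
import Data.Rational.Unnormalised.Properties as ℚᵘₚ
open import Data.Sign.Base as Sign using (Sign)
open import Data.Vec.Base as Vec using (Vec; []; _∷_; tabulate)
import Data.Vec.Properties as Vecₚ
open import Function.Base using (_∘_)
open import Relation.Binary.PropositionalEquality
open import Algebra.Definitions.RawMonoid *-1-rawMonoid using () renaming (sum to ∏)
open +-*-Solver
open ≡-Reasoning
open Convergence using (r; ν; ν-r)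

-- Finite sums and products of rationals.

∑ℓ : ∀ {A : Set} → List A → (A → ℚ) → ℚ
∑ℓ xs f = foldr (λ a s → f a + s) 0ℚ xs

∑ℓ-cong : ∀ {A : Set} (xs : List A) {f g : A → ℚ} → (∀ a → f a ≡ g a) → ∑ℓ xs f ≡ ∑ℓ xs g
∑ℓ-cong []       f≡g = refl
∑ℓ-cong (x ∷ xs) f≡g = cong₂ _+_ (f≡g x) (∑ℓ-cong xs f≡g)

∑ℓ-0 : ∀ {A : Set} (xs : List A) → ∑ℓ xs (λ _ → 0ℚ) ≡ 0ℚ
∑ℓ-0 []       = refl
∑ℓ-0 (x ∷ xs) = trans (ℚₚ.+-identityˡ _) (∑ℓ-0 xs)

∑ℓ-+ : ∀ {A : Set} (xs : List A) (f g : A → ℚ) → ∑ℓ xs (λ a → f a + g a) ≡ ∑ℓ xs f + ∑ℓ xs g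
∑ℓ-+ []       f g = refl
∑ℓ-+ (x ∷ xs) f g = trans (cong (f x + g x +_) (∑ℓ-+ xs f g))
  (solve 4 (λ p q s t → p :+ q :+ (s :+ t) := p :+ s :+ (q :+ t)) refl (f x) (g x) (∑ℓ xs f) (∑ℓ xs g))

∑ℓ-* : ∀ {A : Set} (xs : List A) c (f : A → ℚ) → ∑ℓ xs (λ a → c * f a) ≡ c * ∑ℓ xs f
∑ℓ-* []       c f = sym (ℚₚ.*-zeroʳ c)
∑ℓ-* (x ∷ xs) c f = trans (cong (c * f x +_) (∑ℓ-* xs c f)) (sym (ℚₚ.*-distribˡ-+ c (f x) (∑ℓ xs f)))

∑ℓ-map : ∀ {A B : Set} (h : A → B) (xs : List A) (f : B → ℚ) → ∑ℓ (List.map h xs) f ≡ ∑ℓ xs (f ∘ h)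
∑ℓ-map h []       f = refl
∑ℓ-map h (x ∷ xs) f = cong (f (h x) +_) (∑ℓ-map h xs f)

∑ℓ-++ : ∀ {A : Set} (xs ys : List A) (f : A → ℚ) → ∑ℓ (xs ++ ys) f ≡ ∑ℓ xs f + ∑ℓ ys f
∑ℓ-++ []       ys f = sym (ℚₚ.+-identityˡ _)
∑ℓ-++ (x ∷ xs) ys f = trans (cong (f x +_) (∑ℓ-++ xs ys f)) (sym (ℚₚ.+-assoc (f x) (∑ℓ xs f) (∑ℓ ys f)))

∑ℓ-concatMap : ∀ {A B : Set} (h : A → List B) (xs : List A) (f : B → ℚ) →
               ∑ℓ (concatMap h xs) f ≡ ∑ℓ xs (λ a → ∑ℓ (h a) f)
∑ℓ-concatMap h []       f = refl
∑ℓ-concatMap h (x ∷ xs) f =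
  trans (∑ℓ-++ (h x) (concatMap h xs) f) (cong (∑ℓ (h x) f +_) (∑ℓ-concatMap h xs f))

∑ℓ-swap : ∀ {A B : Set} (xs : List A) (ys : List B) (f : A → B → ℚ) →
          ∑ℓ xs (λ a → ∑ℓ ys (f a)) ≡ ∑ℓ ys (λ b → ∑ℓ xs (λ a → f a b))
∑ℓ-swap []       ys f = sym (∑ℓ-0 ys)
∑ℓ-swap (x ∷ xs) ys f = trans (cong (∑ℓ ys (f x) +_) (∑ℓ-swap xs ys f))
  (sym (∑ℓ-+ ys (f x) (λ b → ∑ℓ xs (λ a → f a b))))

∑ℓ-allFin-suc : ∀ {m} (f : Fin (suc m) → ℚ) →
                ∑ℓ (allFin (suc m)) f ≡ f zero + ∑ℓ (allFin m) (f ∘ suc)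
∑ℓ-allFin-suc {m} f = cong (f zero +_)
  (trans (cong (λ js → ∑ℓ js f) (sym (Listₚ.map-tabulate {n = m} (λ j → j) suc))) (∑ℓ-map suc (allFin m) f))

∑<-cong : ∀ n {f g : ℕ → ℚ} → (∀ k → f k ≡ g k) → ∑< n f ≡ ∑< n g
∑<-cong zero    f≡g = refl
∑<-cong (suc n) f≡g = cong₂ _+_ (∑<-cong n f≡g) (f≡g n)

∑<-+ : ∀ n (f g : ℕ → ℚ) → ∑< n (λ k → f k + g k) ≡ ∑< n f + ∑< n g
∑<-+ zero    f g = refl
∑<-+ (suc n) f g = trans (cong (_+ (f n + g n)) (∑<-+ n f g))
  (solve 4 (λ p q s t → p :+ q :+ (s :+ t) := p :+ s :+ (q :+ t)) refl (∑< n f) (∑< n g) (f n) (g n))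

∑<-* : ∀ n c (f : ℕ → ℚ) → ∑< n (λ k → c * f k) ≡ c * ∑< n f
∑<-* zero    c f = sym (ℚₚ.*-zeroʳ c)
∑<-* (suc n) c f = trans (cong (_+ c * f n) (∑<-* n c f)) (sym (ℚₚ.*-distribˡ-+ c (∑< n f) (f n)))

∑ℓ-∑< : ∀ {A : Set} (xs : List A) n (f : A → ℕ → ℚ) →
        ∑ℓ xs (λ a → ∑< n (f a)) ≡ ∑< n (λ k → ∑ℓ xs (λ a → f a k))
∑ℓ-∑< xs zero    f = ∑ℓ-0 xs
∑ℓ-∑< xs (suc n) f = trans (∑ℓ-+ xs (λ a → ∑< n (f a)) (λ a → f a n))
  (cong (_+ ∑ℓ xs (λ a → f a n)) (∑ℓ-∑< xs n f))

-- Applied with h inferred from the goal: comparing two reals as such would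
-- unfold their convergence proofs.
seq-foldr : ∀ {A : Set} (h : A → ℝ → ℝ) (g : A → ℚ) (xs : List A) n →
            (∀ a y → seq (h a y) n ≡ g a + seq y n) → seq (foldr h 0ℝ xs) n ≡ ∑ℓ xs g
seq-foldr h g []       n h≡g = refl
seq-foldr h g (x ∷ xs) n h≡g = trans (h≡g x (foldr h 0ℝ xs)) (cong (g x +_) (seq-foldr h g xs n h≡g))

⟶0-≡ : (s t : ℕ → ℚ) → (∀ n → s n ≡ t n) → (λ n → s n - t n) ⟶0
⟶0-≡ s t s≡t ε 0<ε = 0 , λ n _ →
  subst (ℚ._< ε) (sym (cong ∣_∣ (trans (cong (_- t n) (s≡t n)) (ℚₚ.+-inverseʳ (t n))))) 0<ε

∏-cong : ∀ {m} {f g : Fin m → ℚ} → (∀ j → f j ≡ g j) → ∏ f ≡ ∏ g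
∏-cong {zero}  f≡g = refl
∏-cong {suc m} f≡g = cong₂ _*_ (f≡g zero) (∏-cong (f≡g ∘ suc))

-- Built from `r`, so that products with `fact` reduce to `ν-r` and ring identities; `inv!-/` links
-- it to `_!`.
inv! : ℕ → ℚ
inv! zero    = 1ℚ
inv! (suc n) = r n * inv! n

fact : ℕ → ℚ
fact zero    = 1ℚ
fact (suc n) = ν (suc n) * fact n

fact*inv! : ∀ n → fact n * inv! n ≡ 1ℚ
fact*inv! zero    = refl
fact*inv! (suc n) = begin
  ν (suc n) * fact n * (r n * inv! n)
    ≡⟨ solve 4 (λ p q s t → p :* q :* (s :* t) := p :* s :* (q :* t)) refl (ν (suc n)) (fact n) (r n) (inv! n) ⟩
  ν (suc n) * r n * (fact n * inv! n)
    ≡⟨ cong₂ _*_ (ν-r n) (fact*inv! n) ⟩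
  1ℚ ∎

-- Sums over all orderings of a tuple.

symmetrise : ∀ {X : Set} {m} → (Vec X m → ℚ) → (Fin m → X) → ℚ
symmetrise {m = m} f xs = ∑ℓ (permutations m) λ ρ → f (tabulate λ j → xs (ρ ⟨$⟩ʳ j))

-- `permutations` is indexed by the image j of the first point and the permutation induced on the
-- rest: `xs j` comes first, and `punchIn j` runs over the other entries.
symmetrise-suc : ∀ {X : Set} {m} (f : Vec X (suc m) → ℚ) (xs : Fin (suc m) → X) →
  symmetrise f xs ≡ ∑ℓ (allFin (suc m)) λ j → symmetrise (λ v → f (xs j ∷ v)) (λ k → xs (punchIn j k))
symmetrise-suc {m = m} f xs = trans
  (∑ℓ-concatMap (λ j → List.map (insert zero j) (permutations m)) (allFin (suc m)) term)
  (∑ℓ-cong (allFin (suc m)) λ j → trans (∑ℓ-map (insert zero j) (permutations m) term)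
    (∑ℓ-cong (permutations m) λ ρ → cong (λ v → f (xs j ∷ v))
      (Vecₚ.tabulate-cong λ k → cong xs (Perm.insert-punchIn zero j ρ k))))
  where term = λ (ρ : Permutation′ (suc m)) → f (tabulate λ j → xs (ρ ⟨$⟩ʳ j))

symmetrise-cong : ∀ {X : Set} {m} {f g : Vec X m → ℚ} (xs : Fin m → X) →
                  (∀ v → f v ≡ g v) → symmetrise f xs ≡ symmetrise g xs
symmetrise-cong {m = m} xs f≡g = ∑ℓ-cong (permutations m) λ ρ → f≡g _

symmetrise-+ : ∀ {X : Set} {m} (f g : Vec X m → ℚ) (xs : Fin m → X) →
               symmetrise (λ v → f v + g v) xs ≡ symmetrise f xs + symmetrise g xs
symmetrise-+ {m = m} f g xs = ∑ℓ-+ (permutations m)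
  (λ ρ → f (tabulate λ j → xs (ρ ⟨$⟩ʳ j))) (λ ρ → g (tabulate λ j → xs (ρ ⟨$⟩ʳ j)))

symmetrise-* : ∀ {X : Set} {m} c (f : Vec X m → ℚ) (xs : Fin m → X) →
               symmetrise (λ v → c * f v) xs ≡ c * symmetrise f xs
symmetrise-* {m = m} c f xs = ∑ℓ-* (permutations m) c λ ρ → f (tabulate λ j → xs (ρ ⟨$⟩ʳ j))

-- Weighted sums over subsets of positions.

module Elementary {X : Set} (g c : X → ℚ) where

  -- E w xs is Σ over subsets A of the positions of
  -- w |A| ∏_{j ∈ A} c(xⱼ) ∏_{j ∉ A} g(xⱼ).
  E : ∀ {m} → (ℕ → ℚ) → (Fin m → X) → ℚ
  E {zero}  w xs = w 0
  E {suc m} w xs = g (xs zero) * E w (xs ∘ suc) + c (xs zero) * E (w ∘ suc) (xs ∘ suc)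

  E-cong : ∀ {m} {w w′ : ℕ → ℚ} (xs : Fin m → X) → (∀ s → w s ≡ w′ s) → E w xs ≡ E w′ xs
  E-cong {zero}  xs w≡w′ = w≡w′ 0
  E-cong {suc m} xs w≡w′ = cong₂ (λ p q → g (xs zero) * p + c (xs zero) * q)
    (E-cong (xs ∘ suc) w≡w′) (E-cong (xs ∘ suc) (w≡w′ ∘ suc))

  E-+ : ∀ {m} (w w′ : ℕ → ℚ) (xs : Fin m → X) → E (λ s → w s + w′ s) xs ≡ E w xs + E w′ xs
  E-+ {zero}  w w′ xs = refl
  E-+ {suc m} w w′ xs = trans
    (cong₂ (λ p q → g (xs zero) * p + c (xs zero) * q)
      (E-+ w w′ (xs ∘ suc)) (E-+ (w ∘ suc) (w′ ∘ suc) (xs ∘ suc)))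
    (solve 6 (λ γ κ p p′ q q′ → γ :* (p :+ p′) :+ κ :* (q :+ q′) :=
                                γ :* p :+ κ :* q :+ (γ :* p′ :+ κ :* q′)) refl
       (g (xs zero)) (c (xs zero)) (E w (xs ∘ suc)) (E w′ (xs ∘ suc))
       (E (w ∘ suc) (xs ∘ suc)) (E (w′ ∘ suc) (xs ∘ suc)))

  E-0 : ∀ {m} (xs : Fin m → X) → E (λ _ → 0ℚ) xs ≡ 0ℚ
  E-0 {zero}  xs = refl
  E-0 {suc m} xs = trans (cong₂ (λ p q → g (xs zero) * p + c (xs zero) * q) (E-0 (xs ∘ suc)) (E-0 (xs ∘ suc)))
    (solve 2 (λ γ κ → γ :* con 0ℚ :+ κ :* con 0ℚ := con 0ℚ) refl (g (xs zero)) (c (xs zero)))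

  -- The recursion of `E` expands the product one factor at a time.
  E-1 : ∀ {m} (xs : Fin m → X) → E (λ _ → 1ℚ) xs ≡ ∏ (λ j → g (xs j) + c (xs j))
  E-1 {zero}  xs = refl
  E-1 {suc m} xs = trans (sym (ℚₚ.*-distribʳ-+ (E (λ _ → 1ℚ) (xs ∘ suc)) (g (xs zero)) (c (xs zero))))
    (cong ((g (xs zero) + c (xs zero)) *_) (E-1 (xs ∘ suc)))

  -- A weight that keeps only the empty subset, that is, the product of all the g's.
  δ : ℚ → ℕ → ℚ
  δ p zero    = p
  δ p (suc _) = 0ℚ

  E-δ : ∀ {m} p (xs : Fin m → X) → E (δ p) xs ≡ p * ∏ (λ j → g (xs j))
  E-δ {zero}  p xs = sym (ℚₚ.*-identityʳ p)
  E-δ {suc m} p xs = trans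
    (cong₂ (λ s t → g (xs zero) * s + c (xs zero) * t) (E-δ p (xs ∘ suc)) (E-0 (xs ∘ suc)))
    (solve 4 (λ γ κ p q → γ :* (p :* q) :+ κ :* con 0ℚ := p :* (γ :* q)) refl
      (g (xs zero)) (c (xs zero)) p (∏ (λ j → g (xs (suc j)))))

  shift : (ℕ → ℚ) → ℕ → ℚ
  shift w zero    = 0ℚ
  shift w (suc s) = ν (suc s) * w s

  -- In a subset of size s + 1 that contains position zero, the added element is either position
  -- zero or one of the s others.
  shift-suc : ∀ w s → w s + shift (w ∘ suc) s ≡ shift w (suc s)
  shift-suc w zero    = solve 1 (λ p → p :+ con 0ℚ := (con 1ℚ :+ con 0ℚ) :* p) refl (w 0)
  shift-suc w (suc s) = solve 2 (λ p n → p :+ n :* p := (con 1ℚ :+ n) :* p) refl (w (suc s)) (ν (suc s))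

  -- Every subset of size s + 1 arises s + 1 times from one of size s by adding a position j.
  E-shift : ∀ {m} w (xs : Fin (suc m) → X) →
    ∑ℓ (allFin (suc m)) (λ j → c (xs j) * E w (λ k → xs (punchIn j k))) ≡ E (shift w) xs
  E-shift {zero}  w xs = solve 3 (λ γ κ p → κ :* p :+ con 0ℚ := γ :* con 0ℚ :+ κ :* ((con 1ℚ :+ con 0ℚ) :* p))
    refl (g (xs zero)) (c (xs zero)) (w 0)
  E-shift {suc m} w xs = begin
    ∑ℓ (allFin (suc (suc m))) (λ j → c (xs j) * E w (λ k → xs (punchIn j k)))
      ≡⟨ ∑ℓ-allFin-suc (λ j → c (xs j) * E w (λ k → xs (punchIn j k))) ⟩
    κ * E w ys + ∑ℓ js (λ j → c (ys j) * (γ * E w (rest j) + κ * E (w ∘ suc) (rest j)))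
      ≡⟨ cong (κ * E w ys +_) (trans
           (∑ℓ-cong js λ j → solve 5 (λ s γ κ p q → s :* (γ :* p :+ κ :* q) := γ :* (s :* p) :+ κ :* (s :* q))
              refl (c (ys j)) γ κ (E w (rest j)) (E (w ∘ suc) (rest j)))
           (trans (∑ℓ-+ js (λ j → γ * (c (ys j) * E w (rest j))) (λ j → κ * (c (ys j) * E (w ∘ suc) (rest j))))
             (cong₂ _+_ (trans (∑ℓ-* js γ (λ j → c (ys j) * E w (rest j))) (cong (γ *_) (E-shift w ys)))
                        (trans (∑ℓ-* js κ (λ j → c (ys j) * E (w ∘ suc) (rest j))) (cong (κ *_) (E-shift (w ∘ suc) ys)))))) ⟩
    κ * E w ys + (γ * E (shift w) ys + κ * E (shift (w ∘ suc)) ys)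
      ≡⟨ solve 5 (λ γ κ p q s → κ :* p :+ (γ :* q :+ κ :* s) := γ :* q :+ κ :* (p :+ s)) refl
           γ κ (E w ys) (E (shift w) ys) (E (shift (w ∘ suc)) ys) ⟩
    γ * E (shift w) ys + κ * (E w ys + E (shift (w ∘ suc)) ys)
      ≡⟨ cong (λ p → γ * E (shift w) ys + κ * p)
           (trans (sym (E-+ w (shift (w ∘ suc)) ys)) (E-cong ys (shift-suc w))) ⟩
    γ * E (shift w) ys + κ * E (shift w ∘ suc) ys ∎
    where
    γ    = g (xs zero)
    κ    = c (xs zero)
    ys   = xs ∘ suc
    js   = allFin (suc m)
    rest = λ j k → ys (punchIn j k)

  -- The s chosen elements can be peeled off in s! orders; with the k removed before them they form
  -- a block of size k + s, which carries 1/(k + s)!.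
  weight : ℕ → ℕ → ℚ
  weight k s = fact s * inv! (k ℕ.+ s)

  -- Either nothing more is chosen, which leaves 1/k!, or one of the s chosen elements is peeled off
  -- first and s - 1 remain, with k + 1 removed.
  weight-shift : ∀ k s → δ (inv! k) s + shift (weight (suc k)) s ≡ weight k s
  weight-shift k zero    = trans (solve 1 (λ p → p :+ con 0ℚ := con 1ℚ :* p) refl (inv! k))
    (cong (λ n → 1ℚ * inv! n) (sym (ℕₚ.+-identityʳ k)))
  weight-shift k (suc s) = trans
    (solve 3 (λ p q t → con 0ℚ :+ p :* (q :* t) := p :* q :* t) refl (ν (suc s)) (fact s) (inv! (suc k ℕ.+ s)))
    (cong (λ n → fact (suc s) * inv! n) (sym (ℕₚ.+-suc k s)))

-- The finite identity for products of sums.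

inv∏! : ∀ {m} → Composition m → ℚ
inv∏! []         = 1ℚ
inv∏! (1+ t ∷ θ) = inv! (suc t) * inv∏! θ

module Quasishuffle {X : Set} (a : X → ℕ → ℚ) where

  ∏ᵇ : ∀ {m} → Vec X m → ℕ → ℚ
  ∏ᵇ []      k = 1ℚ
  ∏ᵇ (x ∷ v) k = a x k * ∏ᵇ v k

  -- A nested sum over n > k₁ > k₂ > ⋯, in the manner of a monomial quasisymmetric function: all
  -- elements of a block share one index.
  M : List (Block X) → ℕ → ℚ
  M []       n = 1ℚ
  M (b ∷ bs) n = ∑[ k < n ] (∏ᵇ (proj₂ b) k * M bs k)

  -- The coefficients are those of Hoffman's exponential from the shuffle to the quasi-shuffle
  -- algebra, which explains why symmetrising gives a plain product.
  W : ∀ {m} → ℕ → Vec X m → ℚ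
  W {m} n v = ∑ℓ (compositions m) λ θ → inv∏! θ * M (blocks θ v) n

  module Step (n : ℕ) where

    -- The first block sits at n and is peeled off element by element; k counts
    -- the elements already removed, which still count in the factorial.
    headAt : ∀ {m} → ℕ → Composition m → Vec X m → ℚ
    headAt k []         v = 0ℚ
    headAt k (1+ t ∷ θ) v = inv! (k ℕ.+ suc t) * inv∏! θ *
      (∏ᵇ (Vec.take (suc t) v) n * M (blocks θ (Vec.drop (suc t) v)) n)

    -- Once k elements have been placed at n, `K` collects both continuations: the block closes with
    -- 1/k! and everything else lies below n, or the block takes further elements, which is `B`.
    B K : ∀ {m} → ℕ → Vec X m → ℚ
    B {m} k v = ∑ℓ (compositions m) λ θ → headAt k θ v
    K k v = inv! k * W n v + B k v

    W-suc : ∀ {m} (v : Vec X m) → W (suc n) v ≡ K 0 v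
    W-suc {m} v = trans
      (∑ℓ-cong (compositions m) λ θ → split θ v)
      (trans (∑ℓ-+ (compositions m) (λ θ → inv∏! θ * M (blocks θ v) n) (λ θ → headAt 0 θ v))
             (cong (_+ B 0 v) (sym (ℚₚ.*-identityˡ (W n v)))))
      where
      split : ∀ {m} (θ : Composition m) v →
              inv∏! θ * M (blocks θ v) (suc n) ≡ inv∏! θ * M (blocks θ v) n + headAt 0 θ v
      split []         v = refl
      split (1+ t ∷ θ) v = ℚₚ.*-distribˡ-+ (inv∏! (1+ t ∷ θ))
        (M (blocks (1+ t ∷ θ) v) n) (∏ᵇ (Vec.take (suc t) v) n * M (blocks θ (Vec.drop (suc t) v)) n)

    -- The two halves of `compositions` match the two continuations in `K`: a first part 1 closes
    -- the block after x, and `grow` lets it continue.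
    B-∷ : ∀ {m} k x (v : Vec X m) → B k (x ∷ v) ≡ a x n * K (suc k) v
    B-∷ {m} k x v = begin
      B k (x ∷ v)
        ≡⟨ ∑ℓ-++ (List.map (1+ 0 ∷_) (compositions m)) (concatMap grow (compositions m)) f ⟩
      ∑ℓ (List.map (1+ 0 ∷_) (compositions m)) f + ∑ℓ (concatMap grow (compositions m)) f
        ≡⟨ cong₂ _+_ (∑ℓ-map (1+ 0 ∷_) (compositions m) f) (∑ℓ-concatMap grow (compositions m) f) ⟩
      ∑ℓ (compositions m) (λ θ → f (1+ 0 ∷ θ)) + ∑ℓ (compositions m) (λ θ → ∑ℓ (grow θ) f)
        ≡⟨ cong₂ _+_ (∑ℓ-cong (compositions m) singleton) (∑ℓ-cong (compositions m) λ θ → grown θ v) ⟩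
      ∑ℓ (compositions m) (λ θ → a x n * inv! (suc k) * (inv∏! θ * M (blocks θ v) n)) +
        ∑ℓ (compositions m) (λ θ → a x n * headAt (suc k) θ v)
        ≡⟨ cong₂ _+_
             (∑ℓ-* (compositions m) (a x n * inv! (suc k)) (λ θ → inv∏! θ * M (blocks θ v) n))
             (∑ℓ-* (compositions m) (a x n) (λ θ → headAt (suc k) θ v)) ⟩
      a x n * inv! (suc k) * W n v + a x n * B (suc k) v
        ≡⟨ solve 4 (λ α p w b → α :* p :* w :+ α :* b := α :* (p :* w :+ b)) refl
             (a x n) (inv! (suc k)) (W n v) (B (suc k) v) ⟩
      a x n * K (suc k) v ∎
      where
      f : Composition (suc m) → ℚ
      f θ = headAt k θ (x ∷ v)

      singleton : ∀ θ → f (1+ 0 ∷ θ) ≡ a x n * inv! (suc k) * (inv∏! θ * M (blocks θ v) n)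
      singleton θ = trans
        (cong (λ s → inv! s * inv∏! θ * (a x n * 1ℚ * M (blocks θ v) n)) (ℕₚ.+-comm k 1))
        (solve 4 (λ p q α μ → p :* q :* (α :* con 1ℚ :* μ) := α :* p :* (q :* μ)) refl
          (inv! (suc k)) (inv∏! θ) (a x n) (M (blocks θ v) n))

      grown : ∀ {m} (θ : Composition m) v →
              ∑ℓ (grow θ) (λ η → headAt k η (x ∷ v)) ≡ a x n * headAt (suc k) θ v
      grown []         v = sym (ℚₚ.*-zeroʳ (a x n))
      grown (1+ t ∷ θ) v = trans
        (cong (λ s → inv! s * inv∏! θ * (a x n * p * μ) + 0ℚ) (ℕₚ.+-suc k (suc t)))
        (solve 5 (λ ι q α p μ → ι :* q :* (α :* p :* μ) :+ con 0ℚ := α :* (ι :* q :* (p :* μ))) refl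
          (inv! (suc k ℕ.+ suc t)) (inv∏! θ) (a x n) p μ)
        where
        p = ∏ᵇ (Vec.take (suc t) v) n
        μ = M (blocks θ (Vec.drop (suc t) v)) n

    open Elementary (λ x → ∑< n (a x)) (λ x → a x n)

    -- Induction on m, given the identity at n as `symW`. Closing the block contributes the empty
    -- subset, through `δ`. Otherwise some `xs j` is the next element of the block and the others
    -- are treated with k + 1, which `E-shift` sums up.
    symmetrise-K : (∀ {m} (xs : Fin m → X) → symmetrise (W n) xs ≡ ∏ (λ j → ∑< n (a (xs j)))) →
                   ∀ {m} k (xs : Fin m → X) → symmetrise (K k) xs ≡ E (weight k) xs
    symmetrise-K symW {zero} k xs = trans
      (solve 1 (λ p → p :* con 1ℚ :+ con 0ℚ :+ con 0ℚ := con 1ℚ :* p) refl (inv! k))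
      (cong (λ n → 1ℚ * inv! n) (sym (ℕₚ.+-identityʳ k)))
    symmetrise-K symW {suc m} k xs = begin
      symmetrise (K k) xs
        ≡⟨ symmetrise-+ (λ v → inv! k * W n v) (B k) xs ⟩
      symmetrise (λ v → inv! k * W n v) xs + symmetrise (B k) xs
        ≡⟨ cong₂ _+_ (trans (symmetrise-* (inv! k) (W n) xs) (cong (inv! k *_) (symW xs))) (symmetrise-suc (B k) xs) ⟩
      inv! k * ∏ (λ j → ∑< n (a (xs j))) +
        ∑ℓ (allFin (suc m)) (λ j → symmetrise (λ v → B k (xs j ∷ v)) (λ i → xs (punchIn j i)))
        ≡⟨ cong₂ _+_ (sym (E-δ (inv! k) xs)) (trans (∑ℓ-cong (allFin (suc m)) pull) (E-shift (weight (suc k)) xs)) ⟩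
      E (δ (inv! k)) xs + E (shift (weight (suc k))) xs
        ≡⟨ sym (E-+ (δ (inv! k)) (shift (weight (suc k))) xs) ⟩
      E (λ s → δ (inv! k) s + shift (weight (suc k)) s) xs
        ≡⟨ E-cong xs (weight-shift k) ⟩
      E (weight k) xs ∎
      where
      pull : ∀ j → symmetrise (λ v → B k (xs j ∷ v)) (λ i → xs (punchIn j i)) ≡
                   a (xs j) n * E (weight (suc k)) (λ i → xs (punchIn j i))
      pull j = trans (symmetrise-cong ys (B-∷ k (xs j)))
        (trans (symmetrise-* (a (xs j) n) (K (suc k)) ys) (cong (a (xs j) n *_) (symmetrise-K symW (suc k) ys)))
        where ys = λ i → xs (punchIn j i)

  symmetrise-W : ∀ n {m} (xs : Fin m → X) → symmetrise (W n) xs ≡ ∏ (λ j → ∑< n (a (xs j)))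
  symmetrise-W zero {zero}  xs = refl
  -- For m ≥ 1 every composition has a first block, whose sum over k < 0 is empty; on the other side
  -- the first factor is 0.
  symmetrise-W zero {suc m} xs = trans
    (symmetrise-cong xs λ v → trans (∑ℓ-cong (compositions (suc m)) (λ θ → vanish θ v)) (∑ℓ-0 (compositions (suc m))))
    (trans (∑ℓ-0 (permutations (suc m))) (sym (ℚₚ.*-zeroˡ (∏ (λ j → ∑< 0 (a (xs (suc j))))))))
    where
    vanish : ∀ {m} (θ : Composition (suc m)) (v : Vec X (suc m)) → inv∏! θ * M (blocks θ v) 0 ≡ 0ℚ
    vanish (1+ t ∷ θ) v = ℚₚ.*-zeroʳ (inv∏! (1+ t ∷ θ))
  symmetrise-W (suc n) xs = begin
    symmetrise (W (suc n)) xs                  ≡⟨ symmetrise-cong xs W-suc ⟩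
    symmetrise (K 0) xs                        ≡⟨ symmetrise-K (symmetrise-W n) 0 xs ⟩
    -- With k = 0 every weight is s!/s! = 1.
    E (weight 0) xs                            ≡⟨ E-cong xs fact*inv! ⟩
    E (λ _ → 1ℚ) xs                            ≡⟨ E-1 xs ⟩
    ∏ (λ j → ∑< (suc n) (a (xs j)))            ∎
    where
    open Step n
    open Elementary (λ x → ∑< n (a x)) (λ x → a x n)

-- Arithmetic of fractions, signs and overlines.

*-/ : ∀ x y d e .{{_ : NonZero d}} .{{_ : NonZero e}} .{{_ : NonZero (d ℕ.* e)}} →
      (x / d) * (y / e) ≡ (x ℤ.* y) / (d ℕ.* e)
*-/ x y (suc d) (suc e) = ℚₚ.toℚᵘ-injective
  (ℚᵘₚ.≃-trans (ℚₚ.toℚᵘ-homo-* (x / suc d) (y / suc e))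
  (ℚᵘₚ.≃-trans (ℚᵘₚ.*-cong (ℚₚ.toℚᵘ-fromℚᵘ (ℚᵘ.mkℚᵘ x d)) (ℚₚ.toℚᵘ-fromℚᵘ (ℚᵘ.mkℚᵘ y e)))
               -- `mkℚᵘ` stores the denominator minus one, and suc d * suc e is the successor of e +
               -- d * suc e.
               (ℚᵘₚ.≃-sym (ℚₚ.toℚᵘ-fromℚᵘ (ℚᵘ.mkℚᵘ (x ℤ.* y) (e ℕ.+ d ℕ.* suc e))))))

*-/suc-^ : ∀ x y k s t → x /suc k ^ s * y /suc k ^ t ≡ (x ℤ.* y) /suc k ^ (s ℕ.+ t)
*-/suc-^ x y k s t = trans (*-/ x y (suc k ℕ.^ s) (suc k ℕ.^ t))
  (ℚₚ./-cong {x ℤ.* y} {p₂ = x ℤ.* y} refl (sym (ℕₚ.^-distribˡ-+-* (suc k) s t)))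
  where
  instance
    _ = ℕₚ.m^n≢0 (suc k) s
    _ = ℕₚ.m^n≢0 (suc k) t
    _ = ℕₚ.m^n≢0 (suc k) (s ℕ.+ t)
    _ = ℕₚ.m*n≢0 (suc k ℕ.^ s) (suc k ℕ.^ t)

inv!-/ : ∀ n → inv! n ≡ (ℤ.+ 1 / n !) {{n ℕₚ.!≢0}}
inv!-/ zero    = refl
inv!-/ (suc n) = trans (cong (r n *_) (inv!-/ n)) (*-/ (ℤ.+ 1) (ℤ.+ 1) (suc n) (n !))
  where
  instance
    _ = n ℕₚ.!≢0
    _ = suc n ℕₚ.!≢0

-- Separates the sign in `coeff` from the factorial weight, so that the sign can be distributed over
-- the entries.
/-∏! : ∀ {m} z (θ : Composition m) → (z / ∏! θ) {{∏!-nonZero θ}} ≡ inv∏! θ * (z / 1)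
/-∏! z []         = sym (ℚₚ.*-identityˡ (z / 1))
/-∏! z (1+ t ∷ θ) = begin
  z / (suc t ! ℕ.* ∏! θ)
    ≡⟨ cong (_/ (suc t ! ℕ.* ∏! θ)) (sym (ℤₚ.*-identityˡ z)) ⟩
  (ℤ.+ 1 ℤ.* z) / (suc t ! ℕ.* ∏! θ)
    ≡⟨ sym (*-/ (ℤ.+ 1) z (suc t !) (∏! θ)) ⟩
  (ℤ.+ 1 / suc t !) * (z / ∏! θ)
    ≡⟨ cong₂ _*_ (sym (inv!-/ (suc t))) (/-∏! z θ) ⟩
  inv! (suc t) * (inv∏! θ * (z / 1))
    ≡⟨ sym (ℚₚ.*-assoc (inv! (suc t)) (inv∏! θ) (z / 1)) ⟩
  inv! (suc t) * inv∏! θ * (z / 1) ∎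
  where
  instance
    _ = suc t ℕₚ.!≢0
    _ = ∏!-nonZero θ
    _ = ∏!-nonZero (1+ t ∷ θ)

^ˢ-* : ∀ σ τ n → (σ Sign.* τ) ^ˢ n ≡ (σ ^ˢ n) ℤ.* (τ ^ˢ n)
^ˢ-* σ τ zero    = refl
^ˢ-* σ τ (suc n) = trans (cong₂ ℤ._*_ (one σ τ) (^ˢ-* σ τ n)) (interchange (σ ℤ.◃ 1) (τ ℤ.◃ 1) (σ ^ˢ n) (τ ^ˢ n))
  where
  one : ∀ σ τ → (σ Sign.* τ) ℤ.◃ 1 ≡ (σ ℤ.◃ 1) ℤ.* (τ ℤ.◃ 1)
  one Sign.+ Sign.+ = refl
  one Sign.+ Sign.- = refl
  one Sign.- Sign.+ = refl
  one Sign.- Sign.- = refl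

sgn : ℕ → Sign
sgn n = toSign (parity n)

sgn-+ : ∀ d e → sgn (d ℕ.+ e) ≡ sgn d Sign.* sgn e
sgn-+ d e = trans (cong toSign (Parityₚ.+-homo-+ d e)) (Parityₚ.+-homo-* (parity d) (parity e))

-- The numerator at n = suc k of a product of terms of H's and of d H̄'s, since (-1)ⁿ⁻¹ = - (-1)ⁿ.
numerator : ℕ → ℕ → ℤ
numerator d k = -1ℤ ℤ.^ d ℤ.* (sgn d ^ˢ suc k)

numerator-0 : ∀ k → numerator 0 k ≡ ℤ.+ 1
numerator-0 k = trans (ℤₚ.*-identityˡ _) (ℤₚ.^-zeroˡ (suc k))

numerator-1 : ∀ k → numerator 1 k ≡ -1ℤ ℤ.^ k
numerator-1 k = trans (sym (ℤₚ.*-assoc -1ℤ -1ℤ (-1ℤ ℤ.^ k))) (ℤₚ.*-identityˡ (-1ℤ ℤ.^ k))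

-- Both the power of -1 and the overline sign turn addition into multiplication, so a block of terms
-- multiplies to a single term.
numerator-+ : ∀ d e k → numerator (d ℕ.+ e) k ≡ numerator d k ℤ.* numerator e k
numerator-+ d e k = trans
  (cong₂ ℤ._*_ (ℤₚ.^-distribˡ-+-* -1ℤ d e)
               (trans (cong (_^ˢ suc k) (sgn-+ d e)) (^ˢ-* (sgn d) (sgn e) (suc k))))
  (interchange (-1ℤ ℤ.^ d) (-1ℤ ℤ.^ e) (sgn d ^ˢ suc k) (sgn e ^ˢ suc k))

numerator-split : ∀ d k s → (-1ℤ ℤ.^ d / 1) * ((sgn d ^ˢ suc k) /suc k ^ s) ≡ numerator d k /suc k ^ s
-- The denominator 1 is read as `suc k` to the power 0.
numerator-split d k s = *-/suc-^ (-1ℤ ℤ.^ d) (sgn d ^ˢ suc k) k 0 s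

χℕ-≤ : ∀ {j l} → j < l → χℕ (ℤ.+ suc j ℤ.- ℤ.+ l) ≡ 0
χℕ-≤ {j} {l} j<l = trans (cong χℕ (trans (ℤₚ.m-n≡m⊖n (suc j) l) (ℤₚ.⊖-≤ j<l))) (χℕ-neg (l ℕ.∸ suc j))
  where
  χℕ-neg : ∀ n → χℕ (ℤ.- ℤ.+ n) ≡ 0
  χℕ-neg zero    = refl
  χℕ-neg (suc n) = refl

χℕ-> : ∀ {j l} → l ≤ j → χℕ (ℤ.+ suc j ℤ.- ℤ.+ l) ≡ 1
χℕ-> {j} {l} l≤j = cong χℕ (trans (ℤₚ.m-n≡m⊖n (suc j) l)
  (trans (ℤₚ.⊖-≥ (ℕₚ.m≤n⇒m≤1+n l≤j)) (cong ℤ.+_ (ℕₚ.+-∸-assoc 1 l≤j))))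

-- Truncated Euler sums and zeta values.

module _ {m : ℕ} (l : ℕ) (i : Fin m → ℕ) (i≥1 : ∀ j → 1 ≤ i j) (q : ℕ) (q≥2 : 2 ≤ q) where

  open EulerSum l i i≥1 q q≥2

  χ : Fin m → ℕ
  χ j = χℕ (ℤ.+ suc (toℕ j) ℤ.- ℤ.+ l)

  -- One formula for the terms of both `H` and `H̄`, chosen by `χ j`, so that block products need no
  -- case distinction.
  term : Fin m → ℕ → ℚ
  term j k = numerator (χ j) k /suc k ^ i j

  open Quasishuffle term

  ∑<-term : ∀ n j → ∑< n (term j) ≡ factor n j
  ∑<-term n j with toℕ j <ᵇ l in j<l
  ... | true  = ∑<-cong n λ k → cong (_/suc k ^ i j)
    (trans (cong (λ d → numerator d k) (χℕ-≤ (ℕₚ.<ᵇ⇒< (toℕ j) l (subst T (sym j<l) _)))) (numerator-0 k))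
  ... | false = ∑<-cong n λ k → cong (_/suc k ^ i j)
    (trans (cong (λ d → numerator d k) (χℕ-> {l = l} (ℕₚ.≮⇒≥ λ j<l′ → subst T j<l (ℕₚ.<⇒<ᵇ j<l′)))) (numerator-1 k))

  ∏ᵇ-term : ∀ {t} (v : Vec (Fin m) t) k →
            ∏ᵇ v k ≡ numerator (Vec.sum (Vec.map χ v)) k /suc k ^ Vec.sum (Vec.map i v)
  ∏ᵇ-term []      k = cong (_/suc k ^ 0) (sym (numerator-0 k))
  ∏ᵇ-term (j ∷ v) k = trans (cong (term j k *_) (∏ᵇ-term v k))
    (trans (*-/suc-^ (numerator (χ j) k) _ k (i j) _)
           (cong (_/suc k ^ (i j ℕ.+ Vec.sum (Vec.map i v))) (sym (numerator-+ (χ j) (Vec.sum (Vec.map χ v)) k))))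

  signed : List (Block (Fin m)) → ℚ
  signed bs = -1ℤ ℤ.^ ℕ.sum (List.map λᵇ bs) / 1

  signed-∷ : ∀ b bs → signed (b ∷ bs) ≡ (-1ℤ ℤ.^ λᵇ b / 1) * signed bs
  signed-∷ b bs = trans (cong (_/ 1) (ℤₚ.^-distribˡ-+-* -1ℤ (λᵇ b) _)) (sym (*-/ (-1ℤ ℤ.^ λᵇ b) _ 1 1))

  sign-entry : ∀ b k → (-1ℤ ℤ.^ λᵇ b / 1) * ((bar (λᵇ b) ^ˢ suc k) /suc k ^ iᵇ b) ≡ ∏ᵇ (proj₂ b) k
  sign-entry (t , v) k = trans (numerator-split (λᵇ (t , v)) k (iᵇ (t , v))) (sym (∏ᵇ-term v k))

  -- The sign splits into one factor per block, and each factor turns its entry of ζ into the block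
  -- product at the same index.
  signed-ζ≤ : ∀ bs n → signed bs * ζ≤ (List.map T̃ bs) n ≡ M bs n
  signed-ζ≤ []       n = refl
  signed-ζ≤ (b ∷ bs) n = trans (sym (∑<-* n (signed (b ∷ bs)) _)) (∑<-cong n λ k →
    trans (cong (_* (p k * ζ≤ (List.map T̃ bs) k)) (signed-∷ b bs))
    (trans (solve 4 (λ s t p z → s :* t :* (p :* z) := s :* p :* (t :* z)) refl
              (-1ℤ ℤ.^ λᵇ b / 1) (signed bs) (p k) (ζ≤ (List.map T̃ bs) k))
           (cong₂ _*_ (sign-entry b k) (signed-ζ≤ bs k))))
    where p = λ k → (bar (λᵇ b) ^ˢ suc k) /suc k ^ iᵇ b

  q⁻ : ℕ → ℚ
  q⁻ n = ℤ.+ 1 /suc n ^ q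

  signed-separate : ∀ bs N → signed bs * ζ≤ (q⁺ ∷ List.map T̃ bs) N ≡ ∑[ n < N ] (q⁻ n * M bs n)
  signed-separate bs N = trans (sym (∑<-* N (signed bs) _)) (∑<-cong N λ n →
    trans (solve 3 (λ s p z → s :* (p :* z) := p :* (s :* z)) refl
            (signed bs) ((Sign.+ ^ˢ suc n) /suc n ^ q) (ζ≤ (List.map T̃ bs) n))
          (cong₂ _*_ (cong (_/suc n ^ q) (ℤₚ.^-zeroˡ (suc n))) (signed-ζ≤ bs n)))

  -- Adding q to the exponent of the first block leaves its λ and hence its overline unchanged, so
  -- 1/n^q factors out.
  signed-merged : ∀ b bs N → signed (b ∷ bs) * ζ≤ (T̂ b ∷ List.map T̃ bs) N ≡
                             ∑[ n < N ] (q⁻ n * (∏ᵇ (proj₂ b) n * M bs n))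
  signed-merged b bs N = trans (sym (∑<-* N (signed (b ∷ bs)) _)) (∑<-cong N λ n →
    trans (cong₂ (λ s t → s * (t * ζ≤ (List.map T̃ bs) n)) (signed-∷ b bs) (split n))
    (trans (solve 5 (λ s t c p z → s :* t :* (c :* p :* z) := c :* (s :* p :* (t :* z))) refl
              (-1ℤ ℤ.^ λᵇ b / 1) (signed bs) (q⁻ n) (p n) (ζ≤ (List.map T̃ bs) n))
           (cong (q⁻ n *_) (cong₂ _*_ (sign-entry b n) (signed-ζ≤ bs n)))))
    where
    p = λ k → (bar (λᵇ b) ^ˢ suc k) /suc k ^ iᵇ b

    split : ∀ n → (bar (λᵇ b) ^ˢ suc n) /suc n ^ (q ℕ.+ iᵇ b) ≡ q⁻ n * p n
    split n = trans (cong (_/suc n ^ (q ℕ.+ iᵇ b)) (sym (ℤₚ.*-identityˡ (bar (λᵇ b) ^ˢ suc n))))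
                    (sym (*-/suc-^ (ℤ.+ 1) (bar (λᵇ b) ^ˢ suc n) n q (iᵇ b)))

  summand : Composition m → Permutation′ m → ℕ → ℚ
  summand θ ρ N = coeff θ ρ * (seq (ζ (q,T̃ θ ρ)) N + seq (ζ (T̂,T̃ θ ρ)) N)

  summand≡ : 1 ≤ m → ∀ θ ρ N →
    summand θ ρ N ≡ ∑[ n < N ] (q⁻ n * (inv∏! θ * M (ρ-blocks θ ρ) (suc n)))
  -- Since m ≥ 1 the composition is not `[]`, so there is a first block to merge with q.
  summand≡ 1≤m (1+ t ∷ θ) ρ N = begin
    coeff (1+ t ∷ θ) ρ * (x + y)
      ≡⟨ cong (_* (x + y)) (/-∏! (-1ℤ ℤ.^ ℕ.sum (List.map λᵇ (b ∷ bs))) (1+ t ∷ θ)) ⟩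
    c * signed (b ∷ bs) * (x + y)
      ≡⟨ solve 4 (λ c s x y → c :* s :* (x :+ y) := c :* (s :* x :+ s :* y)) refl c (signed (b ∷ bs)) x y ⟩
    c * (signed (b ∷ bs) * x + signed (b ∷ bs) * y)
      ≡⟨ cong (c *_) (cong₂ _+_ (signed-separate (b ∷ bs) N) (signed-merged b bs N)) ⟩
    c * (∑< N below + ∑< N at)
      ≡⟨ cong (c *_) (sym (∑<-+ N below at)) ⟩
    c * ∑< N (λ n → below n + at n)
      ≡⟨ sym (∑<-* N c (λ n → below n + at n)) ⟩
    ∑[ n < N ] c * (below n + at n)
      -- By definition `M (b ∷ bs) (suc n)` is `M (b ∷ bs) n` plus the term at n: these are the
      -- separate and the merged zeta value.
      ≡⟨ (∑<-cong N λ n → solve 4 (λ c q x y → c :* (q :* x :+ q :* y) := q :* (c :* (x :+ y))) refl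
            c (q⁻ n) (M (b ∷ bs) n) (∏ᵇ (proj₂ b) n * M bs n)) ⟩
    ∑[ n < N ] (q⁻ n * (c * M (b ∷ bs) (suc n))) ∎
    where
    xs = tabulate (ρ ⟨$⟩ʳ_)
    b  = (t , Vec.take (suc t) xs)
    bs = blocks θ (Vec.drop (suc t) xs)
    c  = inv∏! (1+ t ∷ θ)
    x  = ζ≤ (q⁺ ∷ List.map T̃ (b ∷ bs)) N
    y  = ζ≤ (T̂ b ∷ List.map T̃ bs) N
    below = λ n → q⁻ n * M (b ∷ bs) n
    at    = λ n → q⁻ n * (∏ᵇ (proj₂ b) n * M bs n)

  seq-S : 1 ≤ m → ∀ N →
    seq S N ≡ ∑ℓ (compositions m) (λ θ → ∑ℓ (permutations m) (λ ρ → summand θ ρ N))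
  seq-S 1≤m N = sym (begin
    ∑ℓ (compositions m) (λ θ → ∑ℓ (permutations m) (λ ρ → summand θ ρ N))
      ≡⟨ (∑ℓ-cong (compositions m) λ θ → trans (∑ℓ-cong (permutations m) λ ρ → summand≡ 1≤m θ ρ N)
           (∑ℓ-∑< (permutations m) N λ ρ n → q⁻ n * u n θ ρ)) ⟩
    ∑ℓ (compositions m) (λ θ → ∑[ n < N ] ∑ℓ (permutations m) (λ ρ → q⁻ n * u n θ ρ))
      ≡⟨ ∑ℓ-∑< (compositions m) N (λ θ n → ∑ℓ (permutations m) (λ ρ → q⁻ n * u n θ ρ)) ⟩
    ∑[ n < N ] ∑ℓ (compositions m) (λ θ → ∑ℓ (permutations m) (λ ρ → q⁻ n * u n θ ρ))
      ≡⟨ ∑<-cong N at ⟩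
    seq S N ∎)
    where
    u : ℕ → Composition m → Permutation′ m → ℚ
    u n θ ρ = inv∏! θ * M (ρ-blocks θ ρ) (suc n)

    at : ∀ n → ∑ℓ (compositions m) (λ θ → ∑ℓ (permutations m) (λ ρ → q⁻ n * u n θ ρ)) ≡
               ∏ (factor (suc n)) * q⁻ n
    at n = begin
      ∑ℓ (compositions m) (λ θ → ∑ℓ (permutations m) (λ ρ → q⁻ n * u n θ ρ))
        ≡⟨ ∑ℓ-cong (compositions m) (λ θ → ∑ℓ-* (permutations m) (q⁻ n) (u n θ)) ⟩
      ∑ℓ (compositions m) (λ θ → q⁻ n * ∑ℓ (permutations m) (u n θ))
        ≡⟨ ∑ℓ-* (compositions m) (q⁻ n) (λ θ → ∑ℓ (permutations m) (u n θ)) ⟩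
      q⁻ n * ∑ℓ (compositions m) (λ θ → ∑ℓ (permutations m) (u n θ))
        ≡⟨ cong (q⁻ n *_) (∑ℓ-swap (compositions m) (permutations m) (u n)) ⟩
      -- The entries permuted by ρ are the positions themselves, hence the identity function. The
      -- bound `suc n` matches the outer summation index, which is written `suc n`.
      q⁻ n * symmetrise (W (suc n)) (λ j → j)
        ≡⟨ cong (q⁻ n *_) (trans (symmetrise-W (suc n) (λ j → j)) (∏-cong (∑<-term (suc n)))) ⟩
      q⁻ n * ∏ (factor (suc n))
        ≡⟨ ℚₚ.*-comm (q⁻ n) (∏ (factor (suc n))) ⟩
      ∏ (factor (suc n)) * q⁻ n ∎

theorem4p2 : (m l : ℕ) → 1 ≤ m → l ≤ m →
    (i : Fin m → ℕ) (i≥1 : ∀ j → 1 ≤ i j) →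
    (∀ j k → j Fin.≤ k → toℕ k < l → i j ≤ i k) →
    (∀ j k → l ≤ toℕ j → j Fin.≤ k → i j ≤ i k) →
    (q : ℕ) (q≥2 : 2 ≤ q) →
    let open EulerSum l i i≥1 q q≥2 in
    S ≃ ∑[ θ ∈ compositions m ] ∑[ ρ ∈ permutations m ] coeff θ ρ · (ζ (q,T̃ θ ρ) +ℝ ζ (T̂,T̃ θ ρ))
theorem4p2 m l 1≤m _ i i≥1 _ _ q q≥2 = ⟶0-≡ _ _ λ n →
  trans (seq-S l i i≥1 q q≥2 1≤m n)
    -- Truncation at n passes through the sum over compositions first, then through the inner sum
    -- over permutations.
    (sym (seq-foldr _ (λ θ → ∑ℓ (permutations m) (λ ρ → summand′ θ ρ n)) (compositions m) n λ θ y →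
      cong (_+ seq y n) (seq-foldr _ (λ ρ → summand′ θ ρ n) (permutations m) n λ ρ z → refl)))
  where summand′ = summand l i i≥1 q q≥2
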